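{- Let $d\ge 1$ and let $G$ be a finite $d$-regular graph containing no cycle of length $4$. If $G$ has at least $d^3+d$ vertices, then $b(G)=d+1$.
   Context: A $b$-coloring of a graph $G$ is a proper vertex coloring such that every color class contains a vertex (called dominant) adjacent to at least one vertex of each of the other color classes. The $b$-chromatic number $b(G)$ is the largest integer $k$ such that $G$ admits a $b$-coloring with $k$ colors. (For any graph, $b(G)\le \Delta(G)+1$.) -}

module Defs where

open import Data.Nat using (ℕ; _≤_; suc)
open import Data.Fin using (Fin)
open import Data.List using (List; length; filter; allFin)
open import Data.Product using (Σ; _×_; ∃-syntax)
open import Relation.Nullary using (¬_)
open import Relation.Binary using (Decidable)
open import Relation.Binary.PropositionalEquality using (_≡_; _≢_)

record Graph (n : ℕ) : Set₁ where
  field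
    Adj    : Fin n → Fin n → Set
    adj?   : Decidable Adj
    sym    : ∀ {u v} → Adj u v → Adj v u
    irrefl : ∀ {v} → ¬ Adj v v

open Graph public

degree : ∀ {n} (G : Graph n) → Fin n → ℕ
degree {n} G v = length (filter (adj? G v) (allFin n))

Regular : ∀ {n} → Graph n → ℕ → Set
Regular {n} G d = ∀ (v : Fin n) → degree G v ≡ d

C4Free : ∀ {n} → Graph n → Set
C4Free {n} G = ∀ (a b c e : Fin n) →
  a ≢ b → a ≢ c → a ≢ e → b ≢ c → b ≢ e → c ≢ e →
  ¬ (Adj G a b × Adj G b c × Adj G c e × Adj G e a)

Proper : ∀ {n} (G : Graph n) (k : ℕ) → (Fin n → Fin k) → Set
Proper {n} G k col = ∀ (u v : Fin n) → Adj G u v → col u ≢ col v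

Dominant : ∀ {n} (G : Graph n) (k : ℕ) → (Fin n → Fin k) → Fin n → Set
Dominant {n} G k col v = ∀ (j : Fin k) → j ≢ col v → ∃[ u ] (Adj G v u × col u ≡ j)

IsBColoring : ∀ {n} (G : Graph n) (k : ℕ) → (Fin n → Fin k) → Set
IsBColoring {n} G k col =
  Proper G k col × (∀ (i : Fin k) → ∃[ v ] (col v ≡ i × Dominant G k col v))

HasBColoring : ∀ {n} (G : Graph n) (k : ℕ) → Set
HasBColoring {n} G k = ∃[ col ] IsBColoring G k col

bChromaticIs : ∀ {n} (G : Graph n) (m : ℕ) → Set
bChromaticIs G m = HasBColoring G m × (∀ (k : ℕ) → HasBColoring G k → k ≤ m)

{-# OPTIONS --safe #-}
module Submission where

-- Color the closed neighborhoods of d + 1 vertices, one for each color, so that each of them sees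
-- all other colors; since G is d-regular, the rest can then be colored greedily. The next dominant
-- vertex x is found by applying Hall's theorem to its uncolored neighbors. If this fails, there are
-- sets S of neighbors and T of colors with |S| + |T| large and S × T blocked, hence many paths of
-- length 2 from x into the colored set K. As G has no 4-cycle, double counting edges and 2-paths
-- leaving K shows that fewer than d³ + d vertices can fail, provided that K is slightly smaller than
-- d(d + 1). To ensure this, start from a vertex k and m ≥ d/4 of its neighbors as dominant vertices:
-- each of them wastes no room on k and on itself, and for 2m ≤ d Hall's condition is automatic.

-- The constant d/4 comes out of the double count. Put e = d - 1, and let r be the number of colored
-- non-dominant vertices. A vertex that cannot be made dominant gets weight at least 2e, while all
-- weights sum to at most e(2er + et), so failure everywhere leaves at most er + et/2 vertices
-- uncolored. The term et/2 pays for vertices next to the prescribed color i, and it is the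
-- obstacle: if t = d closed neighborhoods were merely disjoint, with r = td, the bound on n would
-- be d³ + d(d + 1)/2, too large by about d²/2. Saving 2m colored vertices lowers it by 2md, and d³
-- + d(d + 1)/2 - 2md < d³ + d holds exactly when d ≤ 4m. In the star, a conflict at the next leaf
-- needs both |S| and |T| to be at least 1 and at most the number of leaves so far, hence a first
-- leaf always succeeds and later ones do while 2m ≤ d. The weights are useless for e = 0, but for d
-- = 1 the star with one leaf already has d + 1 dominant vertices.

open import Defs
open import Data.Nat using (ℕ; zero; suc; _≤_; _<_; _+_; _*_; _^_; _≤?_; z≤n; s≤s; pred)
open import Data.Nat.Properties hiding (_≟_; suc-injective)
open import Data.Nat.Tactic.RingSolver using (solve-∀)
open import Data.Fin using (Fin; zero; suc; fromℕ<)
open import Data.Fin.Properties using (_≟_; any?; all?; suc-injective)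
open import Data.Product using (Σ; _×_; _,_; proj₁; proj₂; ∃; ∃-syntax)
open import Data.Sum using (_⊎_; inj₁; inj₂; [_,_]′; map₂)
open import Data.Unit using (⊤)
open import Data.Empty using (⊥)
open import Data.Maybe using (Maybe; just; nothing)
open import Data.Maybe.Properties using (just-injective; ≡-dec)
open import Data.List using (List; []; _∷_; length; filter; tabulate; allFin)
open import Data.List.Relation.Unary.Any using (here; there)
open import Data.List.Membership.Propositional using (_∈_)
open import Data.List.Membership.Propositional.Properties using (∈-allFin)
import Data.Vec.Functional as Vector
open import Function using (_∘_; id)
open import Relation.Nullary using (¬_; Dec; yes; no; contradiction; ¬?; _×-dec_; _⊎-dec_)
open import Relation.Unary using (Decidable)
open import Relation.Binary.PropositionalEquality
  using (_≡_; _≢_; refl; trans; cong; cong₂; subst; module ≡-Reasoning) renaming (sym to ≡-sym)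
open import Algebra.Properties.Semiring.Sum +-*-semiring
  using (sum; sum-cong-≗; ∑-distrib-+; ∑-comm; *-distribˡ-sum; *-distribʳ-sum)

-- Counting over Fin n

private variable
  m n o : ℕ
  A B : Set
  P Q R : Fin n → Set

⟦_⟧ : Dec A → ℕ
⟦ yes _ ⟧ = 1
⟦ no _ ⟧ = 0

⟦⟧-true : (a? : Dec A) → A → ⟦ a? ⟧ ≡ 1
⟦⟧-true (yes _) _ = refl
⟦⟧-true (no ¬a) a = contradiction a ¬a

⟦⟧-false : (a? : Dec A) → ¬ A → ⟦ a? ⟧ ≡ 0
⟦⟧-false (yes a) ¬a = contradiction a ¬a
⟦⟧-false (no _) _ = refl

⟦⟧-≤ : (a? : Dec A) {x : ℕ} → (A → 1 ≤ x) → ⟦ a? ⟧ ≤ x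
⟦⟧-≤ (yes a) h = h a
⟦⟧-≤ (no _) h = z≤n

⟦⟧-× : (a? : Dec A) (b? : Dec B) → ⟦ a? ×-dec b? ⟧ ≡ ⟦ a? ⟧ * ⟦ b? ⟧
⟦⟧-× (yes _) (yes _) = refl
⟦⟧-× (yes _) (no _) = refl
⟦⟧-× (no _) _ = refl

sum-mono : {f g : Fin n → ℕ} → (∀ i → f i ≤ g i) → sum f ≤ sum g
sum-mono {zero} h = z≤n
sum-mono {suc n} h = +-mono-≤ (h zero) (sum-mono (h ∘ suc))

full? : Decidable {A = Fin n} (λ _ → ⊤)
full? _ = yes _

opaque
  -- Opaque, so that later goals keep `count` folded; `count-suc` and `count-sum` export the two
  -- unfoldings used outside this block.
  count : {P : Fin n → Set} → Decidable P → ℕ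
  count P? = sum (λ i → ⟦ P? i ⟧)

  count-⊆ : (P? : Decidable P) (Q? : Decidable Q) → (∀ i → P i → Q i) → count P? ≤ count Q?
  count-⊆ P? Q? h = sum-mono λ i → ⟦⟧-≤ (P? i) λ p → ≤-reflexive (≡-sym (⟦⟧-true (Q? i) (h i p)))

  count-⊎ : (P? : Decidable P) (Q? : Decidable Q) (R? : Decidable R) →
    (∀ i → P i → ¬ Q i) → (∀ i → P i → R i) → (∀ i → Q i → R i) →
    count P? + count Q? ≤ count R?
  count-⊎ P? Q? R? disj pr qr = subst (_≤ count R?) (∑-distrib-+ (λ i → ⟦ P? i ⟧) (λ i → ⟦ Q? i ⟧)) (sum-mono pointwise)
    where
    pointwise : ∀ i → ⟦ P? i ⟧ + ⟦ Q? i ⟧ ≤ ⟦ R? i ⟧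
    pointwise i with P? i | Q? i
    ... | yes p | yes q = contradiction q (disj i p)
    ... | yes p | no _ = ≤-reflexive (≡-sym (⟦⟧-true (R? i) (pr i p)))
    ... | no _ | yes q = ≤-reflexive (≡-sym (⟦⟧-true (R? i) (qr i q)))
    ... | no _ | no _ = z≤n

  count-∪ : (R? : Decidable R) (P? : Decidable P) (Q? : Decidable Q) →
    (∀ i → R i → P i ⊎ Q i) → count R? ≤ count P? + count Q?
  count-∪ {P = P} {Q = Q} R? P? Q? h = subst (count R? ≤_) (∑-distrib-+ (λ i → ⟦ P? i ⟧) (λ i → ⟦ Q? i ⟧))
    (sum-mono λ i → ⟦⟧-≤ (R? i) (pointwise i ∘ h i))
    where
    pointwise : ∀ i → P i ⊎ Q i → 1 ≤ ⟦ P? i ⟧ + ⟦ Q? i ⟧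
    pointwise i (inj₁ p) rewrite ⟦⟧-true (P? i) p = s≤s z≤n
    pointwise i (inj₂ q) rewrite ⟦⟧-true (Q? i) q = m≤n+m 1 _

  count-full : ∀ n → count (full? {n}) ≡ n
  count-full zero = refl
  count-full (suc n) = cong suc (count-full n)

  sum-zeros : {f : Fin n → ℕ} → (∀ i → f i ≡ 0) → sum f ≡ 0
  sum-zeros {zero} h = refl
  sum-zeros {suc n} h = cong₂ _+_ (h zero) (sum-zeros (h ∘ suc))


  count-none : (P? : Decidable P) → (∀ i → ¬ P i) → count P? ≡ 0
  count-none P? h = sum-zeros λ i → ⟦⟧-false (P? i) (h i)

  count-≥1 : (P? : Decidable P) {i : Fin n} → P i → 1 ≤ count P?
  count-≥1 P? {zero} p rewrite ⟦⟧-true (P? zero) p = s≤s z≤n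
  count-≥1 P? {suc i} p = ≤-trans (count-≥1 (P? ∘ suc) p) (m≤n+m _ _)

  count-suc : (P? : Decidable {A = Fin (suc n)} P) → count P? ≡ ⟦ P? zero ⟧ + count (P? ∘ suc)
  count-suc P? = refl

  count-sum : (P? : Decidable P) → count P? ≡ sum (λ i → ⟦ P? i ⟧)
  count-sum P? = refl

count-∃ : (P? : Decidable P) → 1 ≤ count P? → ∃ P
count-∃ P? h with any? P?
... | yes e = e
... | no ¬e with () ← subst (1 ≤_) (count-none P? λ i p → ¬e (i , p)) h

count-remove : (P? : Decidable P) {i : Fin n} → P i →
  suc (count (λ j → P? j ×-dec ¬? (j ≟ i))) ≤ count P?
count-remove P? {i} p = ≤-trans (+-monoˡ-≤ _ (count-≥1 (_≟ i) refl))
  (count-⊎ (_≟ i) _ P? (λ { _ refl (_ , ¬e) → ¬e refl }) (λ { _ refl → p }) (λ _ → proj₁))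

count-unique : (P? : Decidable P) → count P? ≤ 1 → ∀ {i j} → P i → P j → i ≡ j
count-unique P? h {i} {j} p q with j ≟ i
... | yes e = ≡-sym e
... | no ¬e = contradiction
  (≤-trans (s≤s (count-≥1 (λ j → P? j ×-dec ¬? (j ≟ i)) (q , ¬e))) (≤-trans (count-remove P? p) h))
  λ { (s≤s ()) }

-- The injection is a relation, since its values usually arise as witnesses of existentials that
-- depend on a proof of `P i`. Each step removes the image of the first element from `Q`.
count-injection : {P : Fin m → Set} {Q : Fin o → Set} (P? : Decidable P) (Q? : Decidable Q)
  (_~_ : Fin m → Fin o → Set) → (∀ i → P i → ∃[ j ] (Q j × i ~ j)) →
  (∀ {i i' j} → i ~ j → i' ~ j → i ≡ i') → count P? ≤ count Q?
count-injection {zero} P? Q? _~_ total inj rewrite count-none P? (λ ()) = z≤n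
count-injection {suc m} P? Q? _~_ total inj rewrite count-suc P? with P? zero
... | no _ = count-injection (P? ∘ suc) Q? (_~_ ∘ suc) (total ∘ suc) (λ r r' → suc-injective (inj r r'))
... | yes p with total zero p
... | j , q , r = ≤-trans (s≤s (count-injection (P? ∘ suc) (λ l → Q? l ×-dec ¬? (l ≟ j)) (_~_ ∘ suc)
  (λ i p' → let l , q' , r' = total (suc i) p' in
     l , (q' , λ { refl → contradiction (inj r r') λ () }) , r')
  (λ r r' → suc-injective (inj r r')))) (count-remove Q? q)

count-≤1 : (P? : Decidable {A = Fin n} P) → (∀ {i j} → P i → P j → i ≡ j) → count P? ≤ 1
count-≤1 {P = P} P? unique = subst (count P? ≤_) (count-full 1)
  (count-injection P? full? (λ i _ → P i) (λ _ p → zero , _ , p) unique)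

count-singleton : (i : Fin n) → count (_≟ i) ≤ 1
count-singleton i = count-≤1 (_≟ i) λ e e' → trans e (≡-sym e')

count-avoid₁ : (P? : Decidable {A = Fin n} P) (i : Fin n) → ¬ P i → suc (count P?) ≤ n
count-avoid₁ {n} P? i ¬p = begin
  suc (count P?)                            ≤⟨ s≤s (count-⊆ P? _ λ j p → _ , λ { refl → ¬p p }) ⟩
  suc (count λ j → full? {n} j ×-dec ¬? (j ≟ i)) ≤⟨ count-remove (full? {n}) _ ⟩
  count (full? {n})                         ≡⟨ count-full n ⟩
  n                                         ∎
  where
  open ≤-Reasoning

count-avoid₂ : (P? : Decidable {A = Fin n} P) (i j : Fin n) → i ≢ j → ¬ P i → ¬ P j →
  suc (suc (count P?)) ≤ n
count-avoid₂ {P = P} P? i j i≢j ¬p ¬q = ≤-trans (s≤s (begin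
  suc (count P?)                                 ≤⟨ s≤s (count-⊆ P? _ λ l p → inj₁ p , λ { refl → ¬p p }) ⟩
  suc (count λ l → Q? l ×-dec ¬? (l ≟ i))        ≤⟨ count-remove Q? (inj₂ refl) ⟩
  count Q?                                       ∎))
  (count-avoid₁ Q? j λ { (inj₁ q) → ¬q q ; (inj₂ e) → i≢j (≡-sym e) })
  where
  open ≤-Reasoning
  Q? : Decidable λ l → P l ⊎ l ≡ i
  Q? l = P? l ⊎-dec (l ≟ i)

-- Hall's theorem

image? : {S : Fin n → Set} {_~_ : Fin n → Fin o → Set} → Decidable S →
  (∀ i j → Dec (i ~ j)) → Decidable (λ j → ∃[ i ] (S i × i ~ j))
image? S? ~? j = any? λ i → S? i ×-dec ~? i j

-- By induction on a bound b for |W|: give some w₀ ∈ W any allowed c₀. If the rest then violates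
-- Hall's condition at S₁, then S₁ has at most |S₁| images including c₀, so S₁ and W \ S₁ can be
-- treated separately, W \ S₁ avoiding the image of S₁.
hall : ∀ b {W : Fin n → Set} {_~_ : Fin n → Fin (suc o) → Set} (W? : Decidable W)
  (~? : ∀ i j → Dec (i ~ j)) → count W? ≤ b →
  (∃[ f ] ((∀ i → W i → i ~ f i) × (∀ i i' → W i → W i' → f i ≡ f i' → i ≡ i')))
  ⊎ Σ (Fin n → Set) λ S → Σ (Decidable S) λ S? →
    (∀ i → S i → W i) × count (image? S? ~?) < count S?
hall b W? ~? h with any? W?
-- `f` is total but constrained only on `W`; the codomain `Fin (suc o)` supplies the default value.
... | no ¬w = inj₁ ((λ _ → zero) , (λ i w → contradiction (i , w) ¬w) , λ i _ w → contradiction (i , w) ¬w)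
hall zero W? ~? h | yes (w₀ , w) = contradiction (≤-trans (count-≥1 W? w) h) λ ()
hall (suc b) {W} {_~_} W? ~? h | yes (w₀ , w) with any? (~? w₀)
... | no ¬c = inj₂ ((λ i → i ≡ w₀) , (_≟ w₀) , (λ { _ refl → w }) ,
  subst (_< count (_≟ w₀)) (≡-sym (count-none (image? (_≟ w₀) ~?) λ { c (_ , refl , r) → ¬c (c , r) }))
    (count-≥1 (_≟ w₀) refl))
... | yes (c₀ , r₀)
  with hall b (λ i → W? i ×-dec ¬? (i ≟ w₀)) (λ i c → ~? i c ×-dec ¬? (c ≟ c₀))
         (≤-pred (≤-trans (count-remove W? w) h))
... | inj₁ (f , f-allowed , f-inj) = inj₁ (g , g-allowed , g-inj)
  where
  g : Fin _ → Fin _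
  g i with i ≟ w₀
  ... | yes _ = c₀
  ... | no _ = f i
  g-allowed : ∀ i → W i → i ~ g i
  g-allowed i wi with i ≟ w₀
  ... | yes refl = r₀
  ... | no ¬e = proj₁ (f-allowed i (wi , ¬e))
  g-inj : ∀ i i' → W i → W i' → g i ≡ g i' → i ≡ i'
  g-inj i i' wi wi' e with i ≟ w₀ | i' ≟ w₀
  ... | yes refl | yes refl = refl
  ... | yes _ | no ¬e = contradiction (≡-sym e) (proj₂ (f-allowed i' (wi' , ¬e)))
  ... | no ¬e | yes _ = contradiction e (proj₂ (f-allowed i (wi , ¬e)))
  ... | no ¬e | no ¬e' = f-inj i i' (wi , ¬e) (wi' , ¬e') e
... | inj₂ (S₁ , S₁? , S₁⊆ , small₁)
  with hall b S₁? ~?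
         (≤-trans (count-⊆ S₁? (λ i → W? i ×-dec ¬? (i ≟ w₀)) S₁⊆) (≤-pred (≤-trans (count-remove W? w) h)))
... | inj₂ (S , S? , S⊆ , small) = inj₂ (S , S? , (λ i s → proj₁ (S₁⊆ i (S⊆ i s))) , small)
... | inj₁ (f , f-allowed , f-inj)
  with hall b (λ i → W? i ×-dec ¬? (S₁? i)) (λ i c → ~? i c ×-dec ¬? (image? S₁? ~? c))
         (≤-pred (≤-trans (+-monoˡ-≤ _ (≤-trans (s≤s z≤n) small₁)) (≤-trans
           (count-⊎ S₁? (λ i → W? i ×-dec ¬? (S₁? i)) W? (λ _ s p → proj₂ p s) (λ i s → proj₁ (S₁⊆ i s)) (λ _ → proj₁)) h)))
... | inj₁ (f' , f'-allowed , f'-inj) = inj₁ (g , g-allowed , g-inj)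
  where
  g : Fin _ → Fin _
  g i with S₁? i
  ... | yes _ = f i
  ... | no _ = f' i
  g-allowed : ∀ i → W i → i ~ g i
  g-allowed i wi with S₁? i
  ... | yes s = f-allowed i s
  ... | no ¬s = proj₁ (f'-allowed i (wi , ¬s))
  g-inj : ∀ i i' → W i → W i' → g i ≡ g i' → i ≡ i'
  g-inj i i' wi wi' e with S₁? i | S₁? i'
  ... | yes s | yes s' = f-inj i i' s s' e
  ... | yes s | no ¬s' = contradiction (i , s , subst (i ~_) e (f-allowed i s)) (proj₂ (f'-allowed i' (wi' , ¬s')))
  ... | no ¬s | yes s' = contradiction (i' , s' , subst (i' ~_) (≡-sym e) (f-allowed i' s')) (proj₂ (f'-allowed i (wi , ¬s)))
  ... | no ¬s | no ¬s' = f'-inj i i' (wi , ¬s) (wi' , ¬s') e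
-- `S₃` has fewer than |S₃| images outside those of `S₁`, and `S₁` has at most |S₁|, so their union
-- violates the condition for `W`.
... | inj₂ (S₃ , S₃? , S₃⊆ , small₃) = inj₂ (S , S? , S⊆W , small)
  where
  open ≤-Reasoning
  S : Fin _ → Set
  S i = S₁ i ⊎ S₃ i
  S? : Decidable S
  S? i = S₁? i ⊎-dec S₃? i
  S⊆W : ∀ i → S i → W i
  S⊆W i (inj₁ s) = proj₁ (S₁⊆ i s)
  S⊆W i (inj₂ s) = proj₁ (S₃⊆ i s)
  N₁? = image? S₁? ~?
  N₁₀? = image? S₁? (λ i c → ~? i c ×-dec ¬? (c ≟ c₀))
  N₃? = image? S₃? (λ i c → ~? i c ×-dec ¬? (image? S₁? ~? c))
  split : ∀ c → ∃[ i ] (S i × i ~ c) → (∃[ i ] (S₁ i × i ~ c)) ⊎ (∃[ i ] (S₃ i × (i ~ c × ¬ (∃[ i ] (S₁ i × i ~ c)))))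
  split c (i , s , r) with N₁? c | s
  ... | yes e | _ = inj₁ e
  ... | no ¬e | inj₁ s₁ = contradiction (i , s₁ , r) ¬e
  ... | no ¬e | inj₂ s₃ = inj₂ (i , s₃ , r , ¬e)
  split₁ : ∀ c → ∃[ i ] (S₁ i × i ~ c) → c ≡ c₀ ⊎ (∃[ i ] (S₁ i × (i ~ c × c ≢ c₀)))
  split₁ c (i , s , r) with c ≟ c₀
  ... | yes e = inj₁ e
  ... | no ¬e = inj₂ (i , s , r , ¬e)
  small : count (image? S? ~?) < count S?
  small = begin-strict
    count (image? S? ~?)                    ≤⟨ count-∪ (image? S? ~?) N₁? N₃? split ⟩
    count N₁? + count N₃?                   ≤⟨ +-monoˡ-≤ _ (count-∪ N₁? (_≟ c₀) N₁₀? split₁) ⟩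
    count (_≟ c₀) + count N₁₀? + count N₃?  ≤⟨ +-monoˡ-≤ _ (+-monoˡ-≤ (count N₁₀?) (count-singleton c₀)) ⟩
    suc (count N₁₀?) + count N₃?            ≤⟨ +-monoˡ-≤ (count N₃?) small₁ ⟩
    count S₁? + count N₃?                   <⟨ +-monoʳ-< (count S₁?) small₃ ⟩
    count S₁? + count S₃?                   ≤⟨ count-⊎ S₁? S₃? S? (λ i s₁ s₃ → proj₂ (S₃⊆ i s₃) s₁) (λ _ → inj₁) (λ _ → inj₂) ⟩
    count S?                                ∎

-- Partial colorings

length-filter-tabulate : ∀ {m} {A : Set} {P : A → Set} (P? : Decidable P) (f : Fin m → A) →
  length (filter P? (tabulate f)) ≡ count (P? ∘ f)
length-filter-tabulate {zero} P? f = ≡-sym (count-none (P? ∘ f) λ ())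
length-filter-tabulate {suc m} P? f rewrite count-suc (P? ∘ f) with P? (f zero)
... | yes _ = cong suc (length-filter-tabulate P? (f ∘ suc))
... | no _ = length-filter-tabulate P? (f ∘ suc)

PartialColoring : ℕ → ℕ → Set
PartialColoring n k = Fin n → Maybe (Fin k)

module _ {n k : ℕ} (col : PartialColoring n k) where

  Colored : Fin n → Set
  Colored u = ∃[ c ] col u ≡ just c

  colored? : Decidable Colored
  colored? u with col u
  ... | just c = yes (c , refl)
  ... | nothing = no λ ()

  hasColor? : (c : Fin k) → Decidable (λ u → col u ≡ just c)
  hasColor? c u = ≡-dec _≟_ (col u) (just c)

module _ {n : ℕ} (G : Graph n) {k : ℕ} (col : PartialColoring n k) where

  PartialProper : Set
  PartialProper = ∀ {u v c} → Adj G u v → col u ≡ just c → col v ≢ just c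

  RainbowAt : Fin n → Set
  RainbowAt x = ∀ {u u' c} → Adj G x u → Adj G x u' → col u ≡ just c → col u' ≡ just c → u ≡ u'

  coloredNbr? : (x : Fin n) → Decidable (λ u → Adj G x u × Colored col u)
  coloredNbr? x u = adj? G x u ×-dec colored? col u

  uncoloredNbr? : (x : Fin n) → Decidable (λ u → Adj G x u × ¬ Colored col u)
  uncoloredNbr? x u = adj? G x u ×-dec ¬? (colored? col u)

module _ {n d : ℕ} (G : Graph n) (regular : Regular G d) where

  degree-count : ∀ v → count (adj? G v) ≡ d
  degree-count v = trans (≡-sym (length-filter-tabulate (adj? G v) id)) (regular v)

  nbrs-split : ∀ {k} (col : PartialColoring n k) x →
    count (coloredNbr? G col x) + count (uncoloredNbr? G col x) ≡ d
  nbrs-split col x = trans (≤-antisym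
    (count-⊎ (coloredNbr? G col x) (uncoloredNbr? G col x) (adj? G x) (λ _ p q → proj₂ q (proj₂ p)) (λ _ → proj₁) (λ _ → proj₁))
    (count-∪ (adj? G x) (coloredNbr? G col x) (uncoloredNbr? G col x) split)) (degree-count x)
    where
    split : ∀ u → Adj G x u → (Adj G x u × Colored col u) ⊎ (Adj G x u × ¬ Colored col u)
    split u a with colored? col u
    ... | yes c = inj₁ (a , c)
    ... | no ¬c = inj₂ (a , ¬c)

  -- A dominant vertex and its d neighbors carry all k colors.
  bColoring-bound : ∀ k → HasBColoring G k → k ≤ suc d
  bColoring-bound zero _ = z≤n
  bColoring-bound (suc k) (col , proper , dominants) with dominants zero
  ... | v , _ , dom = begin
    suc k                            ≡⟨ count-full _ ⟨
    count (full? {_})                       ≤⟨ count-injection full? N? (λ c u → col u ≡ c) (λ c _ → total c) (λ e e' → trans (≡-sym e) e') ⟩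
    count N?                         ≤⟨ count-∪ N? (_≟ v) (adj? G v) (λ _ → id) ⟩
    count (_≟ v) + count (adj? G v)  ≤⟨ +-mono-≤ (count-singleton v) (≤-reflexive (degree-count v)) ⟩
    suc d                            ∎
    where
    open ≤-Reasoning
    N? : Decidable (λ u → u ≡ v ⊎ Adj G v u)
    N? u = (u ≟ v) ⊎-dec adj? G v u
    total : ∀ c → ∃[ u ] ((u ≡ v ⊎ Adj G v u) × col u ≡ c)
    total c with c ≟ col v
    ... | yes e = v , inj₁ refl , ≡-sym e
    ... | no ¬e = let u , a , e = dom c ¬e in u , inj₂ a , e

  greedy-step : (col : PartialColoring n (suc d)) → PartialProper G col → (x : Fin n) →
    Σ (PartialColoring n (suc d)) λ col' →
      PartialProper G col' × (∀ {u c} → col u ≡ just c → col' u ≡ just c) × Colored col' x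
  greedy-step col proper x with colored? col x
  ... | yes c = col , proper , id , c
  ... | no ¬colored with any? (λ c → ¬? (any? λ u → adj? G x u ×-dec hasColor? col c u))
  ... | no all = contradiction (begin
      suc (suc d)                    ≡⟨ cong suc (count-full _) ⟨
      suc (count (full? {_}))               ≤⟨ s≤s (count-injection full? (adj? G x) (λ c u → col u ≡ just c)
                                          (λ c _ → total c) (λ e e' → just-injective (trans (≡-sym e) e'))) ⟩
      suc (count (adj? G x))         ≡⟨ cong suc (degree-count x) ⟩
      suc d                          ∎) 1+n≰n
    where
    open ≤-Reasoning
    total : ∀ c → ∃[ u ] (Adj G x u × col u ≡ just c)
    total c with any? (λ u → adj? G x u ×-dec hasColor? col c u)
    ... | yes e = e
    ... | no ¬e = contradiction (c , ¬e) all
  ... | yes (c₀ , free) = col' , proper' , (λ {u} → old {u}) , c₀ , new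
    where
    col' : PartialColoring n (suc d)
    col' u with u ≟ x
    ... | yes _ = just c₀
    ... | no _ = col u
    old : ∀ {u c} → col u ≡ just c → col' u ≡ just c
    old {u} e with u ≟ x
    ... | yes refl = contradiction (_ , e) ¬colored
    ... | no _ = e
    new : col' x ≡ just c₀
    new with x ≟ x
    ... | yes _ = refl
    ... | no ¬e = contradiction refl ¬e
    proper' : PartialProper G col'
    proper' {u} {v} a e e' with u ≟ x | v ≟ x
    proper' a e e' | yes refl | yes refl = irrefl G a
    proper' {v = v} a refl e' | yes refl | no _ = free (v , a , e')
    proper' {u} a e refl | no _ | yes refl = free (u , sym G a , e)
    ... | no _ | no _ = proper a e e'

  greedy : (col : PartialColoring n (suc d)) → PartialProper G col → (xs : List (Fin n)) →
    Σ (PartialColoring n (suc d)) λ col' →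
      PartialProper G col' × (∀ {u c} → col u ≡ just c → col' u ≡ just c) × (∀ {x} → x ∈ xs → Colored col' x)
  greedy col proper [] = col , proper , id , λ ()
  greedy col proper (x ∷ xs) with greedy-step col proper x
  ... | col₁ , proper₁ , old₁ , _ , x∈ with greedy col₁ proper₁ xs
  ... | col₂ , proper₂ , old₂ , all = col₂ , proper₂ , old₂ ∘ old₁ ,
    λ { (here refl) → _ , old₂ x∈ ; (there i) → all i }

  -- The d neighbors carry d distinct colors, none of them `c₀`. A further missing color `c` would
  -- make d + 2 colors in all.
  dominance : (col : PartialColoring n (suc d)) → ∀ {v c₀} → PartialProper G col →
    col v ≡ just c₀ → (∀ u → Adj G v u → Colored col u) → RainbowAt G col v →
    ∀ c → c ≢ c₀ → ∃[ u ] (Adj G v u × col u ≡ just c)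
  dominance col {v} {c₀} proper v∈c₀ full rainbow c c≢c₀ with any? (λ u → adj? G v u ×-dec hasColor? col c u)
  ... | yes e = e
  ... | no ¬e = contradiction (begin
      suc (suc d)                       ≡⟨ cong (2 +_) (degree-count v) ⟨
      suc (suc (count (adj? G v)))      ≤⟨ s≤s (s≤s (count-injection (adj? G v) used? (λ u c' → Adj G v u × col u ≡ just c')
                                             (λ u a → let c' , e = full u a in c' , (u , a , e) , a , e)
                                             (λ (a , e) (a' , e') → rainbow a a' e e'))) ⟩
      suc (suc (count used?))           ≤⟨ count-avoid₂ used? c c₀ c≢c₀ ¬e (λ (u , a , e) → proper a v∈c₀ e) ⟩
      suc d                             ∎) 1+n≰n
    where
    open ≤-Reasoning
    used? : Decidable (λ c' → ∃[ u ] (Adj G v u × col u ≡ just c'))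
    used? c' = any? λ u → adj? G v u ×-dec hasColor? col c' u

module _ {n : ℕ} (G : Graph n) where

  adj⇒≢ : ∀ {u v} → Adj G u v → u ≢ v
  adj⇒≢ a refl = irrefl G a

  -- Otherwise a, u, b, u' is a 4-cycle. All later uses of `C4Free` go through this form.
  common-nbr-unique : C4Free G → ∀ {a b u u'} → a ≢ b →
    Adj G a u → Adj G b u → Adj G a u' → Adj G b u' → u ≡ u'
  common-nbr-unique c4 {a} {b} {u} {u'} a≢b au bu au' bu' with u ≟ u'
  ... | yes e = e
  ... | no ¬e = contradiction (au , sym G bu , bu' , sym G au')
    (c4 a u b u' (adj⇒≢ au) a≢b (adj⇒≢ au') (adj⇒≢ (sym G bu)) ¬e (adj⇒≢ bu'))

-- Partial colorings with t dominant vertices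

module _ {n d : ℕ} (G : Graph n) where

  -- `saturated` and `rainbow` give dominance by `dominance`; as the whole neighborhood is already
  -- colored, no extension of `col` can destroy it. `covered` keeps the colored set small: it lies
  -- in t closed neighborhoods.
  record State {t : ℕ} (dom : Fin t → Fin n) : Set where
    field
      col : PartialColoring n (suc d)
      proper : PartialProper G col
      hue : Fin t → Fin (suc d)
      hue-injective : ∀ {i j} → hue i ≡ hue j → i ≡ j
      dom-hue : ∀ j → col (dom j) ≡ just (hue j)
      saturated : ∀ j {u} → Adj G (dom j) u → Colored col u
      rainbow : ∀ j → RainbowAt G col (dom j)
      covered : ∀ {u} → Colored col u → ∃[ j ] (u ≡ dom j ⊎ Adj G (dom j) u)

    size : ℕ
    size = count (colored? col)

    -- Consequently a color class has at most one vertex in each closed neighborhood of a dominant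
    -- vertex, hence at most t vertices.
    near-unique : ∀ {j u u' c} → u ≡ dom j ⊎ Adj G (dom j) u → u' ≡ dom j ⊎ Adj G (dom j) u' →
      col u ≡ just c → col u' ≡ just c → u ≡ u'
    near-unique (inj₁ refl) (inj₁ refl) _ _ = refl
    near-unique (inj₁ refl) (inj₂ a) e e' = contradiction e' (proper a e)
    near-unique (inj₂ a) (inj₁ refl) e e' = contradiction e (proper a e')
    near-unique {j} (inj₂ a) (inj₂ a') e e' = rainbow j a a' e e'

    missing-hue : t ≤ d → ∃[ i ] (∀ j → hue j ≢ i)
    missing-hue t≤d with any? (λ i → all? λ j → ¬? (hue j ≟ i))
    ... | yes e = e
    ... | no none = contradiction (begin
        suc d                 ≡⟨ count-full (suc d) ⟨
        count (full? {suc d}) ≤⟨ count-injection full? full? (λ i j → hue j ≡ i) (λ i _ → hit i)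
                                   (λ e e' → trans (≡-sym e) e') ⟩
        count (full? {t})     ≡⟨ count-full t ⟩
        t                     ≤⟨ t≤d ⟩
        d                     ∎) 1+n≰n
      where
      open ≤-Reasoning
      hit : ∀ i → ∃[ j ] (⊤ × hue j ≡ i)
      hit i with any? (λ j → hue j ≟ i)
      ... | yes (j , e) = j , _ , e
      ... | no ¬e = contradiction (i , λ j e → ¬e (j , e)) none

  -- The obstruction given by Hall's theorem to coloring N(x) when x has color i.
  record Conflict (col : PartialColoring n (suc d)) (x : Fin n) (i : Fin (suc d)) : Set₁ where
    field
      S : Fin n → Set
      S? : Decidable S
      T : Fin (suc d) → Set
      T? : Decidable T
      S-nbr : ∀ {w} → S w → Adj G x w
      S-uncolored : ∀ {w} → S w → ¬ Colored col w
      i∉T : ¬ T i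
      T-unused : ∀ {c u} → T c → Adj G x u → col u ≢ just c
      blocked : ∀ {w c} → S w → T c → ∃[ u ] (Adj G w u × col u ≡ just c)
      S-nonempty : 1 ≤ count S?
      T-nonempty : 1 ≤ count T?
      large : suc d ≤ count S? + count T? + count (coloredNbr? G col x)

  -- The cost of coloring x itself: its count is 0 if x is already colored and 1 otherwise.
  newlyCenter? : (col : PartialColoring n (suc d)) (x : Fin n) → Decidable (λ y → y ≡ x × ¬ Colored col y)
  newlyCenter? col x y = (y ≟ x) ×-dec ¬? (colored? col y)

  module Palette (col : PartialColoring n (suc d)) (x : Fin n) (i : Fin (suc d)) where

    NbrColor : Fin n → Fin (suc d) → Set
    NbrColor w c = ∃[ u ] (Adj G w u × col u ≡ just c)

    nbrColor? : ∀ w c → Dec (NbrColor w c)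
    nbrColor? w c = any? λ u → adj? G w u ×-dec hasColor? col c u

    -- Colors that no uncolored neighbor of x may take: `i` by properness at x, the others to keep
    -- N(x) rainbow.
    Used : Fin (suc d) → Set
    Used c = c ≡ i ⊎ NbrColor x c

    used? : Decidable Used
    used? c = (c ≟ i) ⊎-dec nbrColor? x c

    allowed? : ∀ w c → Dec (¬ Used c × ¬ NbrColor w c)
    allowed? w c = ¬? (used? c) ×-dec ¬? (nbrColor? w c)

  -- Hall's theorem matches the uncolored neighbors of x to distinct allowed colors. The two
  -- alternatives for x serve the two phases: a star leaf already has color `i`, whereas the first
  -- vertex and those found by counting are uncolored and see no `i`.
  extend : Regular G d → ∀ {t} {dom : Fin t → Fin n} (s : State dom) (let open State s) →
    (x : Fin n) (i : Fin (suc d)) → (∀ j → hue j ≢ i) →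
    (col x ≡ just i ⊎ (¬ Colored col x × (∀ {u} → Adj G x u → col u ≢ just i))) →
    RainbowAt G col x →
    (Σ (State (x Vector.∷ dom)) λ s' →
      State.size s' ≤ size + (count (newlyCenter? col x) + count (uncoloredNbr? G col x)))
    ⊎ Conflict col x i
  extend regular {t} {dom} s x i missing center-ok rainbow-x
    with hall _ (uncoloredNbr? G (State.col s) x) (Palette.allowed? (State.col s) x i) ≤-refl
  ... | inj₂ (S , S? , S⊆ , small) = inj₂ record
    { S = S ; S? = S? ; T = T ; T? = T?
    ; S-nbr = λ {w} s → proj₁ (S⊆ w s)
    ; S-uncolored = λ {w} s → proj₂ (S⊆ w s)
    ; i∉T = λ (unused , _) → unused (inj₁ refl)
    ; T-unused = λ (unused , _) a e → unused (inj₂ (_ , a , e))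
    ; blocked = blocked
    ; S-nonempty = ≤-trans (s≤s z≤n) small
    -- S consists of uncolored neighbors, so |S| + p₁ ≤ d, while `large` demands d + 1.
    ; T-nonempty = +-cancelˡ-≤ d _ _ (begin
        d + 1                           ≡⟨ +-comm d 1 ⟩
        suc d                           ≤⟨ large ⟩
        count S? + count T? + p₁        ≤⟨ +-monoˡ-≤ p₁ (+-monoˡ-≤ (count T?) (count-⊆ S? W? S⊆)) ⟩
        count W? + count T? + p₁        ≡⟨ +-comm _ p₁ ⟩
        p₁ + (count W? + count T?)      ≡⟨ +-assoc p₁ _ _ ⟨
        p₁ + count W? + count T?        ≡⟨ cong (_+ count T?) (nbrs-split G regular col x) ⟩
        d + count T?                    ∎)
    ; large = large }
    where
    open State s
    open Palette col x i
    open ≤-Reasoning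
    W? = uncoloredNbr? G col x
    p₁ = count (coloredNbr? G col x)
    N? : Decidable λ c → ∃[ w ] (S w × (¬ Used c × ¬ NbrColor w c))
    N? = image? S? allowed?
    T : Fin (suc d) → Set
    T c = ¬ Used c × ¬ (∃[ w ] (S w × (¬ Used c × ¬ NbrColor w c)))
    T? : Decidable T
    T? c = ¬? (used? c) ×-dec ¬? (N? c)
    blocked : ∀ {w c} → S w → T c → NbrColor w c
    blocked {w} {c} s (unused , ¬n) with nbrColor? w c
    ... | yes near = near
    ... | no ¬near = contradiction (w , s , unused , ¬near) ¬n
    split : ∀ c → ⊤ → T c ⊎ (Used c ⊎ ∃[ w ] (S w × (¬ Used c × ¬ NbrColor w c)))
    split c _ with used? c | N? c
    ... | yes u | _ = inj₂ (inj₁ u)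
    ... | no _ | yes n = inj₂ (inj₂ n)
    ... | no ¬u | no ¬n = inj₁ (¬u , ¬n)
    -- Each of the d + 1 colors is `i`, occurs on N(x), is allowed for some w in S, or lies in T.
    -- The allowed ones number fewer than |S|, and this strict inequality absorbs the 1 for `i`.
    large : suc d ≤ count S? + count T? + p₁
    large = begin
      suc d                                       ≡⟨ count-full (suc d) ⟨
      count (full? {suc d})                       ≤⟨ count-∪ full? T? (λ c → used? c ⊎-dec N? c) split ⟩
      count T? + count (λ c → used? c ⊎-dec N? c) ≤⟨ +-monoʳ-≤ (count T?) (count-∪ _ used? N? λ _ z → z) ⟩
      count T? + (count used? + count N?)         ≤⟨ +-monoʳ-≤ (count T?) (+-monoˡ-≤ (count N?)
                                                      (count-∪ used? (_≟ i) (nbrColor? x) λ _ z → z)) ⟩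
      count T? + (count (_≟ i) + count (nbrColor? x) + count N?)
        ≤⟨ +-monoʳ-≤ (count T?) (+-monoˡ-≤ (count N?) (+-mono-≤ (count-singleton i)
             (count-injection (nbrColor? x) (coloredNbr? G col x) (λ c u → col u ≡ just c)
               (λ c (u , a , e) → u , (a , c , e) , e) (λ e e' → just-injective (trans (≡-sym e) e'))))) ⟩
      count T? + (1 + p₁ + count N?)              ≡⟨ cong (λ z → count T? + suc z) (+-comm p₁ _) ⟩
      count T? + (suc (count N?) + p₁)            ≤⟨ +-monoʳ-≤ (count T?) (+-monoˡ-≤ p₁ small) ⟩
      count T? + (count S? + p₁)                  ≡⟨ +-assoc (count T?) _ p₁ ⟨
      count T? + count S? + p₁                    ≡⟨ cong (_+ p₁) (+-comm (count T?) _) ⟩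
      count S? + count T? + p₁                    ∎
  ... | inj₁ (f , f-allowed , f-injective) = inj₁ (record
    { col = col'
    ; proper = λ a e e' → clash a (origin e) (origin e')
    ; hue = i Vector.∷ hue
    ; hue-injective = λ {j} {l} → hue'-injective j l
    ; dom-hue = λ { zero → new-center ; (suc j) → keep (dom-hue j) }
    ; saturated = saturated'
    ; rainbow = rainbow'
    ; covered = λ (_ , e) → covered' (origin e)
    } , size-bound)
    where
    open State s
    open Palette col x i
    open ≤-Reasoning
    col' : PartialColoring n (suc d)
    col' y with col y | y ≟ x | adj? G x y
    ... | just c | _ | _ = just c
    ... | nothing | yes _ | _ = just i
    ... | nothing | no _ | yes _ = just (f y)
    ... | nothing | no _ | no _ = nothing

    -- Inverts `col'`: properness and rainbowness become case distinctions on how two vertices got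
    -- their colors.
    data Origin (y : Fin n) (c : Fin (suc d)) : Set where
      old : col y ≡ just c → Origin y c
      center : ¬ Colored col y → y ≡ x → c ≡ i → Origin y c
      nbr : ¬ Colored col y → Adj G x y → c ≡ f y → Origin y c

    uncolored : ∀ {y} → col y ≡ nothing → ¬ Colored col y
    uncolored e (c , e') with () ← trans (≡-sym e) e'

    origin : ∀ {y c} → col' y ≡ just c → Origin y c
    origin {y} e with col y in eq | y ≟ x | adj? G x y
    origin e | just _ | _ | _ = old (trans eq e)
    origin refl | nothing | yes y≡x | _ = center (uncolored eq) y≡x refl
    origin refl | nothing | no _ | yes a = nbr (uncolored eq) a refl

    keep : ∀ {y c} → col y ≡ just c → col' y ≡ just c
    keep {y} e with col y | y ≟ x | adj? G x y
    ... | just _ | _ | _ = e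

    new-uncolored : ∀ {y} → ¬ Colored col y → y ≡ x → col' y ≡ just i
    new-uncolored {y} ¬colored e with col y | y ≟ x
    ... | just c | _ = contradiction (c , refl) ¬colored
    ... | nothing | yes _ = refl
    ... | nothing | no ¬e = contradiction e ¬e

    new-center : col' x ≡ just i
    new-center = [ keep , (λ (¬colored , _) → new-uncolored ¬colored refl) ]′ center-ok

    center-free : ∀ {u} → ¬ Colored col x → Adj G x u → col u ≢ just i
    center-free ¬colored a = [ (λ e → contradiction (i , e) ¬colored) , (λ (_ , free) → free a) ]′ center-ok

    colored-nbr : ∀ {u} → Adj G x u → Colored col' u
    colored-nbr {u} a with col u | u ≟ x | adj? G x u
    ... | just c | _ | _ = c , refl
    ... | nothing | yes _ | _ = i , refl
    ... | nothing | no _ | yes _ = f u , refl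
    ... | nothing | no _ | no ¬a = contradiction a ¬a

    clash : ∀ {u v c} → Adj G u v → Origin u c → Origin v c → ⊥
    clash a (old e) (old e') = proper a e e'
    clash a (old e) (center ¬colored refl refl) = center-free ¬colored (sym G a) e
    clash a (old e) (nbr ¬colored a' refl) = proj₂ (f-allowed _ (a' , ¬colored)) (_ , sym G a , e)
    clash a (center _ refl _) (center _ refl _) = irrefl G a
    clash a (center _ _ refl) (nbr ¬colored a' e) = proj₁ (f-allowed _ (a' , ¬colored)) (inj₁ (≡-sym e))
    -- Triangles at x are possible, so two newly colored neighbors may be adjacent; injectivity of
    -- the matching separates their colors.
    clash a (nbr ¬colored a₁ e) (nbr ¬colored' a₂ e') =
      adj⇒≢ G a (f-injective _ _ (a₁ , ¬colored) (a₂ , ¬colored') (trans (≡-sym e) e'))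
    clash a (center ¬colored refl refl) (old e) = center-free ¬colored a e
    clash a (nbr ¬colored a' refl) (old e) = proj₂ (f-allowed _ (a' , ¬colored)) (_ , a , e)
    clash a (nbr ¬colored a' e) (center _ _ refl) = proj₁ (f-allowed _ (a' , ¬colored)) (inj₁ (≡-sym e))

    hue'-injective : ∀ j l → (i Vector.∷ hue) j ≡ (i Vector.∷ hue) l → j ≡ l
    hue'-injective zero zero _ = refl
    hue'-injective zero (suc l) e = contradiction (≡-sym e) (missing l)
    hue'-injective (suc j) zero e = contradiction e (missing j)
    hue'-injective (suc j) (suc l) e = cong suc (hue-injective e)

    saturated' : ∀ j {u} → Adj G ((x Vector.∷ dom) j) u → Colored col' u
    saturated' zero a = colored-nbr a
    saturated' (suc j) a = let c , e = saturated j a in c , keep e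

    rainbow-center : ∀ {u u' c} → Adj G x u → Adj G x u' → Origin u c → Origin u' c → u ≡ u'
    rainbow-center a a' (center _ refl _) _ = contradiction a (irrefl G)
    rainbow-center a a' _ (center _ refl _) = contradiction a' (irrefl G)
    rainbow-center a a' (old e) (old e') = rainbow-x a a' e e'
    rainbow-center a a' (old e) (nbr ¬colored a₁ refl) =
      contradiction (inj₂ (_ , a , e)) (proj₁ (f-allowed _ (a₁ , ¬colored)))
    rainbow-center a a' (nbr ¬colored a₁ refl) (old e) =
      contradiction (inj₂ (_ , a' , e)) (proj₁ (f-allowed _ (a₁ , ¬colored)))
    rainbow-center a a' (nbr ¬colored a₁ e) (nbr ¬colored' a₂ e') =
      f-injective _ _ (a₁ , ¬colored) (a₂ , ¬colored') (trans (≡-sym e) e')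

    unchanged : ∀ {u c} → Colored col u → col' u ≡ just c → col u ≡ just c
    unchanged (_ , e) e' = trans e (trans (≡-sym (keep e)) e')

    rainbow' : ∀ j → RainbowAt G col' ((x Vector.∷ dom) j)
    rainbow' zero a a' e e' = rainbow-center a a' (origin e) (origin e')
    rainbow' (suc j) a a' e e' = rainbow j a a' (unchanged (saturated j a) e) (unchanged (saturated j a') e')

    covered' : ∀ {u c} → Origin u c → ∃[ j ] (u ≡ (x Vector.∷ dom) j ⊎ Adj G ((x Vector.∷ dom) j) u)
    covered' (old e) = let j , near = covered (_ , e) in suc j , near
    covered' (center _ e _) = zero , inj₁ e
    covered' (nbr _ a _) = zero , inj₂ a

    newly? : Decidable λ y → (y ≡ x × ¬ Colored col y) ⊎ (Adj G x y × ¬ Colored col y)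
    newly? y = newlyCenter? col x y ⊎-dec uncoloredNbr? G col x y

    split : ∀ y → Colored col' y →
      Colored col y ⊎ ((y ≡ x × ¬ Colored col y) ⊎ (Adj G x y × ¬ Colored col y))
    split y (c , e) with origin e
    ... | old e' = inj₁ (c , e')
    ... | center ¬colored e' _ = inj₂ (inj₁ (e' , ¬colored))
    ... | nbr ¬colored a _ = inj₂ (inj₂ (a , ¬colored))

    size-bound : count (colored? col') ≤ size + (count (newlyCenter? col x) + count (uncoloredNbr? G col x))
    size-bound = begin
      count (colored? col')       ≤⟨ count-∪ (colored? col') (colored? col) newly? split ⟩
      size + count newly?         ≤⟨ +-monoʳ-≤ size (count-∪ newly? (newlyCenter? col x) (uncoloredNbr? G col x) λ _ z → z) ⟩
      size + (count (newlyCenter? col x) + count (uncoloredNbr? G col x)) ∎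

-- The initial star of dominant vertices

module _ {n d : ℕ} (G : Graph n) (regular : Regular G d) where

  -- A conflict would exhibit a colored blocking vertex, but nothing is colored yet.
  initial : (k : Fin n) → Σ (State {d = d} G (k Vector.∷ λ ())) λ s → State.size s ≤ suc d
  initial k with extend G regular empty k zero (λ ()) (inj₂ ((λ ()) , λ _ ())) (λ _ _ ())
    where
    empty : State {d = d} G {0} (λ ())
    empty = record
      { col = λ _ → nothing
      ; proper = λ _ ()
      ; hue = λ ()
      ; hue-injective = λ { {()} }
      ; dom-hue = λ ()
      ; saturated = λ ()
      ; rainbow = λ ()
      ; covered = λ ()
      }
  ... | inj₁ (s , bound) = s , (begin
    State.size s                                          ≤⟨ bound ⟩
    count (colored? empty) + (count (newlyCenter? G empty k) + count (uncoloredNbr? G empty k))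
      ≡⟨ cong (_+ (count (newlyCenter? G empty k) + count (uncoloredNbr? G empty k))) (count-none (colored? empty) λ _ ()) ⟩
    count (newlyCenter? G empty k) + count (uncoloredNbr? G empty k)
      ≤⟨ +-mono-≤ (count-≤1 (newlyCenter? G empty k) λ (e , _) (e' , _) → trans e (≡-sym e'))
                  (count-⊆ (uncoloredNbr? G empty k) (adj? G k) λ _ → proj₁) ⟩
    1 + count (adj? G k)                                  ≡⟨ cong suc (degree-count G regular k) ⟩
    suc d                                                 ∎)
    where
    open ≤-Reasoning
    empty : PartialColoring n (suc d)
    empty _ = nothing
  ... | inj₂ conflict with count-∃ (Conflict.S? conflict) (Conflict.S-nonempty conflict)
                         | count-∃ (Conflict.T? conflict) (Conflict.T-nonempty conflict)
  ... | _ , w∈S | _ , c∈T with () ← proj₂ (proj₂ (Conflict.blocked conflict w∈S c∈T))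

  module _ (c4 : C4Free G) where

    -- The star center dom j₀ has a neighbor x of the missing color i, which is made dominant.
    module Leaf {l : ℕ} {dom : Fin (suc l) → Fin n} (s : State {d = d} G dom) (j₀ : Fin (suc l))
      (star : ∀ j → dom j ≡ dom j₀ ⊎ Adj G (dom j₀) (dom j))
      (i : Fin (suc d)) (missing : ∀ j → State.hue s j ≢ i)
      (x : Fin n) (k~x : Adj G (dom j₀) x) (x∈i : State.col s x ≡ just i) where
      open State s
      open ≤-Reasoning

      k : Fin n
      k = dom j₀

      dom≢x : ∀ j → dom j ≢ x
      dom≢x j refl = missing j (just-injective (trans (≡-sym (dom-hue j)) x∈i))

      -- If u is adjacent to a leaf `dom j`, then u and k are both common neighbors of `dom j` and
      -- x, so u = k.
      nbr-in-star : ∀ {u} → Adj G x u → Colored col u → u ≡ k ⊎ Adj G k u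
      nbr-in-star a c with covered c
      ... | j , inj₁ refl = star j
      ... | j , inj₂ a' with star j
      ... | inj₁ e = inj₂ (subst (λ v → Adj G v _) e a')
      ... | inj₂ a₁ = inj₁ (common-nbr-unique G c4 (dom≢x j) a' a (sym G a₁) (sym G k~x))

      rainbow-x : RainbowAt G col x
      rainbow-x a a' e e' = near-unique {j₀} (nbr-in-star a (_ , e)) (nbr-in-star a' (_ , e')) e e'

      -- They are k and at most one common neighbor of k and x.
      fewColoredNbrs : count (coloredNbr? G col x) ≤ 2
      fewColoredNbrs = ≤-trans
        (count-∪ (coloredNbr? G col x) (_≟ k) both? split)
        (+-mono-≤ (count-singleton k) (count-≤1 both?
          λ (a , b) (a' , b') → common-nbr-unique G c4 (dom≢x j₀) a b a' b'))
        where
        both? : Decidable λ u → Adj G k u × Adj G x u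
        both? u = adj? G k u ×-dec adj? G x u
        split : ∀ u → Adj G x u × Colored col u → u ≡ k ⊎ (Adj G k u × Adj G x u)
        split u (a , c) = map₂ (_, a) (nbr-in-star a c)

      module _ (conflict : Conflict G col x i) where
        open Conflict conflict

        Blocker : Fin n → Fin (suc d) → Fin (suc l) → Set
        Blocker w c j = ∃[ u ] (Adj G w u × col u ≡ just c × (u ≡ dom j ⊎ Adj G (dom j) u))

        -- The center blocks nothing. If u = k, then w is in N(k) and hence colored. If u is in
        -- N(k), then k and w are common neighbors of x and u, so w = k is colored; here u ≠ x
        -- because x has color `i`, which is not in T.
        blocker : ∀ {w c} → S w → T c → ∃[ j ] (j ≢ j₀ × Blocker w c j)
        blocker {w} {c} w∈S c∈T with blocked w∈S c∈T
        ... | u , w~u , e with covered (_ , e)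
        ... | j , near = j , (λ { refl → off-center near }) , u , w~u , e , near
          where
          off-center : ¬ (u ≡ k ⊎ Adj G k u)
          off-center (inj₁ refl) = S-uncolored w∈S (saturated j₀ (sym G w~u))
          off-center (inj₂ k~u) = S-uncolored w∈S (subst (Colored col) k≡w (_ , dom-hue j₀))
            where
            x≢u : x ≢ u
            x≢u refl = i∉T (subst T (just-injective (trans (≡-sym e) x∈i)) c∈T)
            k≡w : k ≡ w
            k≡w = common-nbr-unique G c4 x≢u (sym G k~x) (sym G k~u) (S-nbr w∈S) (sym G w~u)

        others : count (λ j → ¬? (j ≟ j₀)) ≤ l
        others = ≤-pred (count-avoid₁ (λ j → ¬? (j ≟ j₀)) j₀ λ ¬e → ¬e refl)

        -- For a fixed c in T, the leaf j determines the blocking vertex u, and w is the only common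
        -- neighbor of x and u.
        S-bound : count S? ≤ l
        S-bound with count-∃ T? T-nonempty
        ... | c , c∈T = ≤-trans
          (count-injection S? (λ j → ¬? (j ≟ j₀)) (λ w j → S w × Blocker w c j)
            (λ w w∈S → let j , j≢j₀ , b = blocker w∈S c∈T in j , j≢j₀ , w∈S , b) injective) others
          where
          injective : ∀ {w w' j} → S w × Blocker w c j → S w' × Blocker w' c j → w ≡ w'
          injective (w∈S , u , a , e , near) (w'∈S , u' , a' , e' , near') with near-unique near near' e e'
          ... | refl = common-nbr-unique G c4 x≢u (S-nbr w∈S) (sym G a) (S-nbr w'∈S) (sym G a')
            where
            x≢u : x ≢ u
            x≢u refl = i∉T (subst T (just-injective (trans (≡-sym e) x∈i)) c∈T)

        -- For a fixed w in S, the leaf j determines u as the only common neighbor of w and `dom j`,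
        -- and u determines its color c.
        T-bound : count T? ≤ l
        T-bound with count-∃ S? S-nonempty
        ... | w , w∈S = ≤-trans
          (count-injection T? (λ j → ¬? (j ≟ j₀)) (Blocker w) (λ c → blocker w∈S) injective) others
          where
          injective : ∀ {c c' j} → Blocker w c j → Blocker w c' j → c ≡ c'
          injective (_ , a , _ , inj₁ refl) _ = contradiction (saturated _ (sym G a)) (S-uncolored w∈S)
          injective _ (_ , a , _ , inj₁ refl) = contradiction (saturated _ (sym G a)) (S-uncolored w∈S)
          injective {j = j} (u , a , e , inj₂ b) (u' , a' , e' , inj₂ b') =
            just-injective (trans (≡-sym e) (trans (cong col u≡u') e'))
            where
            u≡u' : u ≡ u'
            u≡u' = common-nbr-unique G c4 (λ { refl → S-uncolored w∈S (_ , dom-hue j) }) a b a' b'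

        conflict⇒large : 1 ≤ l × d < suc l + suc l
        conflict⇒large = ≤-trans S-nonempty S-bound , (begin
          suc d                                               ≤⟨ large ⟩
          count S? + count T? + count (coloredNbr? G col x)   ≤⟨ +-mono-≤ (+-mono-≤ S-bound T-bound) fewColoredNbrs ⟩
          l + l + 2                                           ≡⟨ arith l ⟩
          suc l + suc l                                       ∎)
          where
          arith : ∀ l → l + l + 2 ≡ suc l + suc l
          arith = solve-∀

      -- Of the d + 1 vertices of the closed neighborhood of x, both x and k are colored beforehand,
      -- so at most d - 1 are new.
      leaf : (1 ≤ l → suc l + suc l ≤ d) → Σ (State {d = d} G (x Vector.∷ dom)) λ s' → suc (State.size s') ≤ size + d
      leaf small with extend G regular s x i missing (inj₁ x∈i) rainbow-x
      ... | inj₂ conflict = let 1≤l , d< = conflict⇒large conflict in contradiction (≤-trans d< (small 1≤l)) 1+n≰n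
      ... | inj₁ (s' , bound) = s' , (begin
        suc (State.size s')      ≤⟨ s≤s bound ⟩
        suc (size + (count (newlyCenter? G col x) + W))
          ≡⟨ cong (λ z → suc (size + (z + W))) (count-none (newlyCenter? G col x) λ { _ (refl , ¬c) → ¬c (_ , x∈i) }) ⟩
        suc (size + W)           ≡⟨ +-suc size W ⟨
        size + suc W             ≤⟨ +-monoʳ-≤ size (+-monoˡ-≤ W (count-≥1 (coloredNbr? G col x) (sym G k~x , _ , dom-hue j₀))) ⟩
        size + (count (coloredNbr? G col x) + W)
                                 ≡⟨ cong (size +_) (nbrs-split G regular col x) ⟩
        size + d                 ∎)
        where
        W = count (uncoloredNbr? G col x)

    record Star (l : ℕ) : Set where
      field
        dom : Fin (suc l) → Fin n
        state : State {d = d} G dom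
        j₀ : Fin (suc l)
        spokes : ∀ j → dom j ≡ dom j₀ ⊎ Adj G (dom j₀) (dom j)
        -- t disjoint closed neighborhoods have t(d + 1) vertices; each leaf of the star saves two.
        compact : State.size state + 2 * l ≤ suc l * suc d

    -- The center is dominant, so a missing hue occurs on one of its neighbors, which becomes the
    -- next leaf.
    star : Fin n → ∀ l → l ≤ d → (2 ≤ l → l + l ≤ d) → Star l
    star k zero _ _ = record
      { dom = k Vector.∷ λ ()
      ; state = proj₁ (initial k)
      ; j₀ = zero
      ; spokes = λ { zero → inj₁ refl }
      ; compact = +-monoˡ-≤ 0 (proj₂ (initial k)) }
    star k (suc l) l<d small = record
      { dom = x Vector.∷ dom
      ; state = proj₁ next
      ; j₀ = suc j₀
      ; spokes = λ { zero → inj₂ k~x ; (suc j) → spokes j }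
      ; compact = begin
          size' + 2 * suc l         ≡⟨ arith₁ size' l ⟩
          suc size' + (1 + 2 * l)   ≤⟨ +-monoˡ-≤ (1 + 2 * l) (proj₂ next) ⟩
          size + d + (1 + 2 * l)    ≡⟨ arith₂ size d (2 * l) ⟩
          suc d + (size + 2 * l)    ≤⟨ +-monoʳ-≤ (suc d) compact ⟩
          suc d + suc l * suc d     ∎ }
      where
      open ≤-Reasoning
      open Star (star k l (<⇒≤ l<d) λ 2≤l → ≤-trans (+-mono-≤ (n≤1+n l) (n≤1+n l)) (small (m≤n⇒m≤1+n 2≤l)))
      open State state
      fresh : ∃[ i ] (∀ j → hue j ≢ i)
      fresh = missing-hue l<d
      i = proj₁ fresh
      spoke : ∃[ x ] (Adj G (dom j₀) x × col x ≡ just i)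
      spoke = dominance G regular col proper (dom-hue j₀) (λ _ → saturated j₀) (rainbow j₀) i
        (λ e → proj₂ fresh j₀ (≡-sym e))
      x = proj₁ spoke
      k~x = proj₁ (proj₂ spoke)
      next = Leaf.leaf state j₀ spokes i (proj₂ fresh) x k~x (proj₂ (proj₂ spoke)) (λ 1≤l → small (s≤s 1≤l))
      size' = State.size (proj₁ next)
      arith₁ : ∀ a l → a + 2 * suc l ≡ suc a + (1 + 2 * l)
      arith₁ = solve-∀
      arith₂ : ∀ a d l → a + d + (1 + l) ≡ suc d + (a + l)
      arith₂ = solve-∀

-- Adding a dominant vertex by double counting

find-or-all : ∀ {n} {A B : Fin n → Set} → (∀ x → A x ⊎ B x) → ∃ A ⊎ (∀ x → B x)
find-or-all {zero} h = inj₂ λ ()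
find-or-all {suc n} h with h zero | find-or-all (h ∘ suc)
... | inj₁ a | _ = inj₁ (zero , a)
... | inj₂ _ | inj₁ (x , a) = inj₁ (suc x , a)
... | inj₂ b | inj₂ bs = inj₂ λ { zero → b ; (suc x) → bs x }

-- This is (a - 1)(b - 1) ≥ 0.
product-bound₁ : ∀ {a b e} → 1 ≤ a → 1 ≤ b → suc e ≤ a + b → e ≤ a * b
product-bound₁ {suc a} {suc b} {e} _ _ h = begin
  e                 ≤⟨ ≤-pred h ⟩
  a + suc b         ≤⟨ m≤m+n _ (a * b) ⟩
  a + suc b + a * b ≡⟨ arith a b ⟩
  suc a * suc b     ∎
  where
  open ≤-Reasoning
  arith : ∀ a b → a + suc b + a * b ≡ suc a * suc b
  arith = solve-∀

-- This is (a - 2)(b - 2) ≥ 0, or ab ≥ 2(a + b - 2).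
product-bound₂ : ∀ {a b e} → 2 ≤ a → 2 ≤ b → 2 + e ≤ a + b → e + e ≤ a * b
product-bound₂ {suc (suc a)} {suc (suc b)} {e} _ _ (s≤s (s≤s h)) = begin
  e + e                                             ≤⟨ +-mono-≤ h h ⟩
  (a + suc (suc b)) + (a + suc (suc b))             ≤⟨ m≤m+n _ (a * b) ⟩
  (a + suc (suc b)) + (a + suc (suc b)) + a * b     ≡⟨ arith a b ⟩
  suc (suc a) * suc (suc b)                         ∎
  where
  open ≤-Reasoning
  arith : ∀ a b → (a + suc (suc b)) + (a + suc (suc b)) + a * b ≡ suc (suc a) * suc (suc b)
  arith = solve-∀
product-bound₂ {suc zero} (s≤s ()) _ _
product-bound₂ {suc (suc _)} {suc zero} _ (s≤s ()) _

-- u, K: numbers of uncolored and colored vertices; r: number of non-dominant colored ones.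
budget : ∀ {n u K r t m e} → u + K ≡ n → r + t ≤ K → K + 2 * m ≤ t * suc (suc e) →
  t ≤ suc e → suc e ≤ 4 * m → 2 * u ≤ 2 * (e * r) + e * t → n < suc e ^ 3 + suc e
budget {n} {u} {K} {r} {t} {m} {e} refl r+t≤K compact t≤d d≤4m 2u≤ with m≤n⇒∃[o]m+o≡n r+t≤K
-- To avoid subtraction and halves, both sides are doubled and d² is added: d² ≤ 4md is how the
-- saving enters, and 4md joins 2d(r + z) to form 2d(r + z + 2m).
... | z , refl = *-cancelˡ-< 2 _ _ (+-cancelʳ-< (d * d) _ _ (begin-strict
    2 * (u + (r + t + z)) + d * d                        ≤⟨ +-monoʳ-≤ (2 * (u + (r + t + z))) (*-monoʳ-≤ d d≤4m) ⟩
    2 * (u + (r + t + z)) + d * (4 * m)                  ≡⟨ cong (_+ d * (4 * m)) (*-distribˡ-+ 2 u (r + t + z)) ⟩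
    2 * u + 2 * (r + t + z) + d * (4 * m)                ≤⟨ +-monoˡ-≤ (d * (4 * m)) (+-monoˡ-≤ (2 * (r + t + z)) 2u≤) ⟩
    2 * (e * r) + e * t + 2 * (r + t + z) + d * (4 * m)  ≤⟨ m≤m+n _ (2 * (e * z)) ⟩
    2 * (e * r) + e * t + 2 * (r + t + z) + d * (4 * m) + 2 * (e * z)
                                                         ≡⟨ arith₁ e r t z m ⟩
    2 * d * (r + z + 2 * m) + (2 + e) * t                ≤⟨ +-mono-≤ (*-monoʳ-≤ (2 * d) R≤) (*-monoʳ-≤ (2 + e) t≤d) ⟩
    2 * d * (d * d) + (2 + e) * d                        <⟨ m<m+n _ (s≤s z≤n) ⟩
    2 * d * (d * d) + (2 + e) * d + d                    ≡⟨ arith₂ e ⟩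
    2 * (d ^ 3 + d) + d * d                              ∎))
  where
  open ≤-Reasoning
  d = suc e
  arith₁ : ∀ e r t z m → 2 * (e * r) + e * t + 2 * (r + t + z) + suc e * (4 * m) + 2 * (e * z)
    ≡ 2 * suc e * (r + z + 2 * m) + (2 + e) * t
  arith₁ = solve-∀
  arith₂ : ∀ e → 2 * suc e * (suc e * suc e) + (2 + e) * suc e + suc e
    ≡ 2 * (suc e * (suc e * (suc e * 1)) + suc e) + suc e * suc e
  arith₂ = solve-∀
  arith₃ : ∀ r t z m → t + (r + z + 2 * m) ≡ r + t + z + 2 * m
  arith₃ = solve-∀
  R≤ : r + z + 2 * m ≤ d * d
  R≤ = ≤-trans (+-cancelˡ-≤ t _ _ (begin
    t + (r + z + 2 * m)  ≡⟨ arith₃ r t z m ⟩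
    r + t + z + 2 * m    ≤⟨ compact ⟩
    t * suc d            ≡⟨ *-suc t d ⟩
    t + t * d            ∎)) (*-monoˡ-≤ d t≤d)

module _ {n : ℕ} (G : Graph n) where

  -- The adjacency matrix applied to the vector `g`.
  nbrSum : (Fin n → ℕ) → Fin n → ℕ
  nbrSum g x = sum λ y → ⟦ adj? G x y ⟧ * g y

  nbrSum-count : {P : Fin n → Set} (P? : Decidable P) (x : Fin n) →
    count (λ y → adj? G x y ×-dec P? y) ≡ nbrSum (λ y → ⟦ P? y ⟧) x
  nbrSum-count P? x = trans (count-sum _) (sum-cong-≗ λ y → ⟦⟧-× (adj? G x y) (P? y))

  adj-symmetric : ∀ x y → ⟦ adj? G x y ⟧ ≡ ⟦ adj? G y x ⟧
  adj-symmetric x y with adj? G x y | adj? G y x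
  ... | yes _ | yes _ = refl
  ... | yes a | no ¬a = contradiction (sym G a) ¬a
  ... | no ¬a | yes a = contradiction (sym G a) ¬a
  ... | no _ | no _ = refl

  -- The adjacency matrix is symmetric. Each double count below is an instance, exchanging the two
  -- ends of an edge.
  nbrSum-adjoint : (f g : Fin n → ℕ) → sum (λ x → f x * nbrSum g x) ≡ sum (λ y → g y * nbrSum f y)
  nbrSum-adjoint f g = begin
    sum (λ x → f x * nbrSum g x)                            ≡⟨ sum-cong-≗ (λ x → *-distribˡ-sum (f x) (λ y → ⟦ adj? G x y ⟧ * g y)) ⟩
    sum (λ x → sum λ y → f x * (⟦ adj? G x y ⟧ * g y))      ≡⟨ ∑-comm (λ x y → f x * (⟦ adj? G x y ⟧ * g y)) ⟩
    sum (λ y → sum λ x → f x * (⟦ adj? G x y ⟧ * g y))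
      ≡⟨ sum-cong-≗ (λ y → sum-cong-≗ λ x → trans (cong (λ a → f x * (a * g y)) (adj-symmetric x y)) (rotate (f x) ⟦ adj? G y x ⟧ (g y))) ⟩
    sum (λ y → sum λ x → g y * (⟦ adj? G y x ⟧ * f x))      ≡⟨ sum-cong-≗ (λ y → *-distribˡ-sum (g y) (λ x → ⟦ adj? G y x ⟧ * f x)) ⟨
    sum (λ y → g y * nbrSum f y)                            ∎
    where
    open ≡-Reasoning
    rotate : ∀ a b c → a * (b * c) ≡ c * (b * a)
    rotate = solve-∀

module Step {n e : ℕ} (G : Graph n) (regular : Regular G (suc e)) (c4 : C4Free G)
  {t : ℕ} {dom : Fin t → Fin n} (s : State {d = suc e} G dom)
  (i : Fin (suc (suc e))) (missing : ∀ j → State.hue s j ≢ i) where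
  open State s

  iNbr? : (x : Fin n) → Decidable (λ u → Adj G x u × col u ≡ just i)
  iNbr? x u = adj? G x u ×-dec hasColor? col i u

  inner outer inner₂ iInner : Fin n → ℕ
  inner x = count (coloredNbr? G col x)
  outer x = count (uncoloredNbr? G col x)
  inner₂ x = sum λ w → ⟦ uncoloredNbr? G col x w ⟧ * inner w
  iInner x = count (iNbr? x)

  Extension : Fin n → Set
  Extension x = Σ (State {d = suc e} G (x Vector.∷ dom)) λ s' → State.size s' ≤ size + suc (suc e)

  module _ {x : Fin n} (¬colored : ¬ Colored col x) (conflict : Conflict G col x i) where
    open Conflict conflict
    open ≤-Reasoning

    T≤inner : ∀ {w} → S w → count T? ≤ inner w
    T≤inner {w} w∈S = count-injection T? (coloredNbr? G col w) (λ c u → col u ≡ just c)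
      (λ c c∈T → let u , a , e = blocked w∈S c∈T in u , (a , c , e) , e)
      (λ e e' → just-injective (trans (≡-sym e) e'))

    -- Every w in S sees all colors of T, hence starts at least |T| edges into the colored set.
    product≤inner₂ : count S? * count T? ≤ inner₂ x
    product≤inner₂ = begin
      count S? * count T?                     ≡⟨ cong (_* count T?) (count-sum S?) ⟩
      sum (λ w → ⟦ S? w ⟧) * count T?         ≡⟨ *-distribʳ-sum (count T?) (λ w → ⟦ S? w ⟧) ⟩
      sum (λ w → ⟦ S? w ⟧ * count T?)         ≤⟨ sum-mono pointwise ⟩
      inner₂ x                                ∎
      where
      pointwise : ∀ w → ⟦ S? w ⟧ * count T? ≤ ⟦ uncoloredNbr? G col x w ⟧ * inner w
      pointwise w with S? w
      ... | no _ = z≤n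
      ... | yes w∈S rewrite ⟦⟧-true (uncoloredNbr? G col x w) (S-nbr w∈S , S-uncolored w∈S) =
        *-monoʳ-≤ 1 (T≤inner w∈S)

    -- Any w in S has the uncolored neighbor x, which leaves at most e colored ones.
    T≤e : count T? ≤ e
    T≤e with count-∃ S? S-nonempty
    ... | w , w∈S = ≤-trans (T≤inner w∈S) (≤-pred (begin
      suc (inner w)       ≡⟨ +-comm 1 (inner w) ⟩
      inner w + 1         ≤⟨ +-monoʳ-≤ (inner w) (count-≥1 (uncoloredNbr? G col w) (sym G (S-nbr w∈S) , ¬colored)) ⟩
      inner w + outer w   ≡⟨ nbrs-split G regular col w ⟩
      suc e               ∎))

    -- Each w ∈ S sees c inside some N(dom j), and hue j, which is neither c nor i, determines w.
    S≤e : count S? ≤ e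
    S≤e with count-∃ T? T-nonempty
    ... | c , c∈T = ≤-trans
      (count-injection S? other? Via total injective)
      (≤-pred (≤-pred (count-avoid₂ other? c i (λ { refl → i∉T c∈T }) (λ (≢c , _) → ≢c refl) (λ (_ , ≢i) → ≢i refl))))
      where
      other? : Decidable λ c' → c' ≢ c × c' ≢ i
      other? c' = ¬? (c' ≟ c) ×-dec ¬? (c' ≟ i)
      Via : Fin n → Fin (suc (suc e)) → Set
      Via w c' = S w × ∃[ j ] (hue j ≡ c' × ∃[ u ] (Adj G w u × col u ≡ just c × Adj G (dom j) u))
      total : ∀ w → S w → ∃[ c' ] ((c' ≢ c × c' ≢ i) × Via w c')
      total w w∈S with blocked w∈S c∈T
      ... | u , a , u∈c with covered (_ , u∈c)
      ... | j , inj₁ refl = contradiction (saturated j (sym G a)) (S-uncolored w∈S)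
      ... | j , inj₂ b = hue j ,
        ((λ { refl → proper b (dom-hue j) u∈c }) , missing j) , w∈S , j , refl , u , a , u∈c , b
      injective : ∀ {w w' c'} → Via w c' → Via w' c' → w ≡ w'
      injective (w∈S , j , ej , u , a , u∈c , b) (w'∈S , j' , ej' , u' , a' , u'∈c , b')
        with hue-injective (trans ej (≡-sym ej'))
      ... | refl with rainbow j b b' u∈c u'∈c
      ... | refl = common-nbr-unique G c4 (λ { refl → ¬colored (_ , u∈c) })
        (S-nbr w∈S) (sym G a) (S-nbr w'∈S) (sym G a')

  -- Every failing x has weight e · inner x + inner₂ x + e · iInner x ≥ 2e, where inner₂ counts 2-paths
  -- x–w–K with w uncolored, and iInner is there because x cannot get color i next to a vertex of color i.
  attempt : ∀ x → ¬ Colored col x → Extension x ⊎ e + e ≤ e * inner x + inner₂ x + e * iInner x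
  attempt x ¬colored with 2 ≤? inner x | 1 ≤? iInner x
  ... | yes 2≤ | _ = inj₂ (begin
      e + e                                     ≡⟨ cong (e +_) (+-identityʳ e) ⟨
      2 * e                                     ≡⟨ *-comm 2 e ⟩
      e * 2                                     ≤⟨ *-monoʳ-≤ e 2≤ ⟩
      e * inner x                               ≤⟨ m≤m+n _ (inner₂ x) ⟩
      e * inner x + inner₂ x                    ≤⟨ m≤m+n _ (e * iInner x) ⟩
      e * inner x + inner₂ x + e * iInner x     ∎)
    where open ≤-Reasoning
  -- A neighbor of color `i` counts in both `inner` and `iInner`, giving e twice.
  ... | no _ | yes 1≤ = inj₂ (begin
      e + e                                     ≡⟨ cong₂ _+_ (*-identityʳ e) (*-identityʳ e) ⟨
      e * 1 + e * 1                             ≤⟨ +-mono-≤ (*-monoʳ-≤ e (≤-trans 1≤ (count-⊆ (iNbr? x) (coloredNbr? G col x)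
                                                      λ _ (a , c) → a , _ , c))) (*-monoʳ-≤ e 1≤) ⟩
      e * inner x + e * iInner x                ≤⟨ +-monoˡ-≤ (e * iInner x) (m≤m+n _ (inner₂ x)) ⟩
      e * inner x + inner₂ x + e * iInner x     ∎)
    where open ≤-Reasoning
  -- At most one neighbor is colored, so N(x) is rainbow, and none has color `i`: `extend` applies.
  ... | no ¬2≤ | no ¬1≤
    with extend G regular s x i missing
           (inj₂ (¬colored , λ a c → ¬1≤ (count-≥1 (iNbr? x) (a , c))))
           (λ a a' c c' → count-unique (coloredNbr? G col x) (≤-pred (≰⇒> ¬2≤)) (a , _ , c) (a' , _ , c'))
  ... | inj₁ (s' , bound) = inj₁ (s' , (begin
      State.size s'       ≤⟨ bound ⟩
      size + (count (newlyCenter? G col x) + outer x)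
        ≤⟨ +-monoʳ-≤ size (+-mono-≤ (count-≤1 (newlyCenter? G col x) λ (e , _) (e' , _) → trans e (≡-sym e'))
             (≤-trans (m≤n+m (outer x) (inner x)) (≤-reflexive (nbrs-split G regular col x)))) ⟩
      size + suc (suc e)  ∎))
    where open ≤-Reasoning
  ... | inj₂ conflict with 1 ≤? inner x
  -- The one colored neighbor contributes e, and |S| + |T| ≥ d gives |S| · |T| ≥ e.
  ... | yes 1≤ = inj₂ (begin
      e + e                                     ≤⟨ +-mono-≤ (≤-trans (≤-reflexive (≡-sym (*-identityʳ e))) (*-monoʳ-≤ e 1≤))
           (≤-trans (product-bound₁ S-nonempty T-nonempty (+-cancelʳ-≤ 1 _ _ (begin
               suc e + 1                        ≡⟨ +-comm (suc e) 1 ⟩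
               suc (suc e)                      ≤⟨ large ⟩
               count S? + count T? + inner x    ≤⟨ +-monoʳ-≤ (count S? + count T?) (≤-pred (≰⇒> ¬2≤)) ⟩
               count S? + count T? + 1          ∎)))
             (product≤inner₂ ¬colored conflict)) ⟩
      e * inner x + inner₂ x                    ≤⟨ m≤m+n _ (e * iInner x) ⟩
      e * inner x + inner₂ x + e * iInner x     ∎)
    where
    open ≤-Reasoning
    open Conflict conflict
  -- Without colored neighbors, |S| · |T| alone must reach 2e. As |S| + |T| ≥ e + 2 and neither
  -- exceeds e, both are at least 2.
  ... | no ¬1≤in = inj₂ (begin
      e + e                                     ≤⟨ product-bound₂ 2≤S 2≤T large' ⟩
      count S? * count T?                       ≤⟨ product≤inner₂ ¬colored conflict ⟩
      inner₂ x                                  ≤⟨ m≤n+m _ (e * inner x) ⟩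
      e * inner x + inner₂ x                    ≤⟨ m≤m+n _ (e * iInner x) ⟩
      e * inner x + inner₂ x + e * iInner x     ∎)
    where
    open ≤-Reasoning
    open Conflict conflict
    large' : 2 + e ≤ count S? + count T?
    large' = begin
      2 + e                                     ≤⟨ large ⟩
      count S? + count T? + inner x             ≡⟨ cong (count S? + count T? +_) (n<1⇒n≡0 (≰⇒> ¬1≤in)) ⟩
      count S? + count T? + 0                   ≡⟨ +-identityʳ _ ⟩
      count S? + count T?                       ∎
    2≤S : 2 ≤ count S?
    2≤S = +-cancelʳ-≤ e 2 (count S?) (≤-trans large' (+-monoʳ-≤ (count S?) (T≤e ¬colored conflict)))
    2≤T : 2 ≤ count T?
    2≤T = +-cancelʳ-≤ e 2 (count T?) (≤-trans large'
      (≤-trans (+-monoˡ-≤ (count T?) (S≤e ¬colored conflict)) (≤-reflexive (+-comm e (count T?)))))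

  blank? : Decidable (λ x → ¬ Colored col x)
  blank? x = ¬? (colored? col x)

  blank : Fin n → ℕ
  blank x = ⟦ blank? x ⟧

  dominant? : Decidable (λ u → ∃[ j ] (dom j ≡ u))
  dominant? u = any? λ j → dom j ≟ u

  minor? : Decidable (λ u → Colored col u × ¬ (∃[ j ] (dom j ≡ u)))
  minor? u = colored? col u ×-dec ¬? (dominant? u)

  outer-nbrSum : ∀ u → outer u ≡ nbrSum G blank u
  outer-nbrSum = nbrSum-count G blank?

  -- Such a vertex is adjacent to a dominant one, which is colored.
  outer-minor : ∀ {u} → Colored col u → ¬ (∃[ j ] (dom j ≡ u)) → outer u ≤ e
  outer-minor {u} c minor with covered c
  ... | j , inj₁ refl = contradiction (j , refl) minor
  ... | j , inj₂ a = ≤-pred (begin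
    1 + outer u         ≤⟨ +-monoˡ-≤ (outer u) (count-≥1 (coloredNbr? G col u) (sym G a , _ , dom-hue j)) ⟩
    inner u + outer u   ≡⟨ nbrs-split G regular col u ⟩
    suc e               ∎)
    where open ≤-Reasoning

  -- Edges leaving the colored set, counted from inside: none at dominant vertices, at most e at the
  -- others.
  inner-total : sum (λ x → blank x * inner x) ≤ e * count minor?
  inner-total = begin
    sum (λ x → blank x * inner x)                        ≡⟨ sum-cong-≗ (λ x → cong (blank x *_) (nbrSum-count G (colored? col) x)) ⟩
    sum (λ x → blank x * nbrSum G (λ u → ⟦ colored? col u ⟧) x) ≡⟨ nbrSum-adjoint G blank (λ u → ⟦ colored? col u ⟧) ⟩
    sum (λ u → ⟦ colored? col u ⟧ * nbrSum G blank u)    ≡⟨ sum-cong-≗ (λ u → cong (⟦ colored? col u ⟧ *_) (≡-sym (outer-nbrSum u))) ⟩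
    sum (λ u → ⟦ colored? col u ⟧ * outer u)             ≤⟨ sum-mono pointwise ⟩
    sum (λ u → e * ⟦ minor? u ⟧)                         ≡⟨ *-distribˡ-sum e (λ u → ⟦ minor? u ⟧) ⟨
    e * sum (λ u → ⟦ minor? u ⟧)                         ≡⟨ cong (e *_) (count-sum minor?) ⟨
    e * count minor?                                     ∎
    where
    open ≤-Reasoning
    pointwise : ∀ u → ⟦ colored? col u ⟧ * outer u ≤ e * ⟦ minor? u ⟧
    pointwise u with colored? col u | dominant? u
    ... | no _ | _ = z≤n
    ... | yes c | yes (j , refl) rewrite count-none (uncoloredNbr? G col (dom j)) (λ _ (a , ¬c) → ¬c (saturated j a)) = z≤n
    ... | yes c | no ¬d = begin
      1 * outer u  ≡⟨ *-identityˡ (outer u) ⟩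
      outer u      ≤⟨ outer-minor c ¬d ⟩
      e            ≡⟨ *-identityʳ e ⟨
      e * 1        ∎

  -- Color `i` occurs at most once in each of the t closed neighborhoods, and never at a dominant
  -- vertex since it is a missing hue.
  iInner-total : sum (λ x → blank x * iInner x) ≤ e * t
  iInner-total = begin
    sum (λ x → blank x * iInner x)                       ≡⟨ sum-cong-≗ (λ x → cong (blank x *_) (nbrSum-count G (hasColor? col i) x)) ⟩
    sum (λ x → blank x * nbrSum G (λ u → ⟦ hasColor? col i u ⟧) x) ≡⟨ nbrSum-adjoint G blank (λ u → ⟦ hasColor? col i u ⟧) ⟩
    sum (λ u → ⟦ hasColor? col i u ⟧ * nbrSum G blank u) ≡⟨ sum-cong-≗ (λ u → cong (⟦ hasColor? col i u ⟧ *_) (≡-sym (outer-nbrSum u))) ⟩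
    sum (λ u → ⟦ hasColor? col i u ⟧ * outer u)          ≤⟨ sum-mono pointwise ⟩
    sum (λ u → e * ⟦ hasColor? col i u ⟧)                ≡⟨ *-distribˡ-sum e (λ u → ⟦ hasColor? col i u ⟧) ⟨
    e * sum (λ u → ⟦ hasColor? col i u ⟧)                ≡⟨ cong (e *_) (count-sum (hasColor? col i)) ⟨
    e * count (hasColor? col i)                          ≤⟨ *-monoʳ-≤ e (count-injection (hasColor? col i) (full? {t})
        (λ u j → col u ≡ just i × (u ≡ dom j ⊎ Adj G (dom j) u))
        (λ u c → let j , near = covered (_ , c) in j , _ , c , near)
        (λ (c , near) (c' , near') → near-unique near near' c c')) ⟩
    e * count (full? {t})                                ≡⟨ cong (e *_) (count-full t) ⟩
    e * t                                                ∎
    where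
    open ≤-Reasoning
    pointwise : ∀ u → ⟦ hasColor? col i u ⟧ * outer u ≤ e * ⟦ hasColor? col i u ⟧
    pointwise u with hasColor? col i u
    ... | no _ = z≤n
    ... | yes c = begin
      1 * outer u  ≡⟨ *-identityˡ (outer u) ⟩
      outer u      ≤⟨ outer-minor (_ , c) (λ { (j , refl) → missing j (just-injective (trans (≡-sym (dom-hue j)) c)) }) ⟩
      e            ≡⟨ *-identityʳ e ⟨
      e * 1        ∎

  -- Grouped by the middle vertex w: with a colored neighbors it lies on a(d - a) such paths, which
  -- is at most ea because a = 0 or d - a ≤ e.
  inner₂-total : sum (λ x → blank x * inner₂ x) ≤ e * sum (λ x → blank x * inner x)
  inner₂-total = begin
    sum (λ x → blank x * inner₂ x)                       ≡⟨ sum-cong-≗ (λ x → cong (blank x *_) (sum-cong-≗ λ w →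
        trans (cong (_* inner w) (⟦⟧-× (adj? G x w) (blank? w))) (*-assoc ⟦ adj? G x w ⟧ (blank w) (inner w)))) ⟩
    sum (λ x → blank x * nbrSum G (λ w → blank w * inner w) x) ≡⟨ nbrSum-adjoint G blank (λ w → blank w * inner w) ⟩
    sum (λ w → blank w * inner w * nbrSum G blank w)     ≡⟨ sum-cong-≗ (λ w → cong (blank w * inner w *_) (≡-sym (outer-nbrSum w))) ⟩
    sum (λ w → blank w * inner w * outer w)              ≤⟨ sum-mono (λ w → ≤-trans (≤-reflexive (*-assoc (blank w) (inner w) (outer w)))
        (≤-trans (*-monoʳ-≤ (blank w) (pointwise (inner w) (outer w) (nbrs-split G regular col w)))
          (≤-reflexive (exchange (blank w) e (inner w))))) ⟩
    sum (λ w → e * (blank w * inner w))                  ≡⟨ *-distribˡ-sum e (λ w → blank w * inner w) ⟨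
    e * sum (λ w → blank w * inner w)                    ∎
    where
    open ≤-Reasoning
    pointwise : ∀ a b → a + b ≡ suc e → a * b ≤ e * a
    pointwise zero b _ = z≤n
    pointwise (suc a) b h = begin
      suc a * b  ≤⟨ *-monoʳ-≤ (suc a) (≤-trans (m≤n+m b a) (≤-reflexive (cong pred h))) ⟩
      suc a * e  ≡⟨ *-comm (suc a) e ⟩
      e * suc a  ∎
    exchange : ∀ a b c → a * (b * c) ≡ b * (a * c)
    exchange = solve-∀

  -- After summation all three parts of the weight carry a factor e, which is cancelled; this
  -- requires e to be positive.
  all-fail : (∀ x → ¬ Colored col x → e + e ≤ e * inner x + inner₂ x + e * iInner x) → 1 ≤ e →
    2 * count blank? ≤ 2 * (e * count minor?) + e * t
  all-fail fail (s≤s _) = *-cancelˡ-≤ e (begin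
    e * (2 * count blank?)                        ≡⟨ arith₁ e (count blank?) ⟩
    (e + e) * count blank?                        ≡⟨ cong ((e + e) *_) (count-sum blank?) ⟩
    (e + e) * sum blank                           ≡⟨ *-distribˡ-sum (e + e) blank ⟩
    sum (λ x → (e + e) * blank x)                 ≤⟨ sum-mono pointwise ⟩
    sum (λ x → e * (blank x * inner x) + blank x * inner₂ x + e * (blank x * iInner x))
      ≡⟨ trans (∑-distrib-+ (λ x → e * (blank x * inner x) + blank x * inner₂ x) (λ x → e * (blank x * iInner x)))
           (cong (_+ sum λ x → e * (blank x * iInner x)) (∑-distrib-+ (λ x → e * (blank x * inner x)) (λ x → blank x * inner₂ x))) ⟩
    sum (λ x → e * (blank x * inner x)) + sum (λ x → blank x * inner₂ x) + sum (λ x → e * (blank x * iInner x))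
      ≡⟨ cong₂ (λ a b → a + sum (λ x → blank x * inner₂ x) + b) (*-distribˡ-sum e (λ x → blank x * inner x)) (*-distribˡ-sum e (λ x → blank x * iInner x)) ⟨
    e * p + sum (λ x → blank x * inner₂ x) + e * q   ≤⟨ +-monoˡ-≤ (e * q) (+-monoʳ-≤ (e * p) inner₂-total) ⟩
    e * p + e * p + e * q                         ≤⟨ +-mono-≤ (+-mono-≤ (*-monoʳ-≤ e inner-total) (*-monoʳ-≤ e inner-total)) (*-monoʳ-≤ e iInner-total) ⟩
    e * (e * r) + e * (e * r) + e * (e * t)       ≡⟨ arith₂ e (e * r) (e * t) ⟩
    e * (2 * (e * r) + e * t)                     ∎)
    where
    open ≤-Reasoning
    p = sum (λ x → blank x * inner x)
    q = sum (λ x → blank x * iInner x)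
    r = count minor?
    arith₁ : ∀ e a → e * (2 * a) ≡ (e + e) * a
    arith₁ = solve-∀
    arith₂ : ∀ e a b → e * a + e * a + e * b ≡ e * (2 * a + b)
    arith₂ = solve-∀
    pointwise : ∀ x → (e + e) * blank x ≤ e * (blank x * inner x) + blank x * inner₂ x + e * (blank x * iInner x)
    pointwise x with colored? col x
    ... | yes _ = ≤-trans (≤-reflexive (*-zeroʳ (e + e))) z≤n
    ... | no ¬c = begin
      (e + e) * 1                                 ≡⟨ *-identityʳ (e + e) ⟩
      e + e                                       ≤⟨ fail x ¬c ⟩
      e * inner x + inner₂ x + e * iInner x       ≡⟨ arith₃ e (inner x) (inner₂ x) (iInner x) ⟩
      e * (1 * inner x) + 1 * inner₂ x + e * (1 * iInner x) ∎
      where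
      arith₃ : ∀ e a b c → e * a + b + e * c ≡ e * (1 * a) + 1 * b + e * (1 * c)
      arith₃ = solve-∀

  step : ∀ {m} → 1 ≤ e → t ≤ suc e → suc e ≤ 4 * m → size + 2 * m ≤ t * suc (suc e) →
    suc e ^ 3 + suc e ≤ n → ∃ Extension
  step {m} 1≤e t≤d d≤4m compact large with find-or-all attempt'
    where
    attempt' : ∀ x → Extension x ⊎ (¬ Colored col x → e + e ≤ e * inner x + inner₂ x + e * iInner x)
    attempt' x with colored? col x
    ... | yes c = inj₂ λ ¬c → contradiction c ¬c
    ... | no ¬c = map₂ (λ h _ → h) (attempt x ¬c)
  ... | inj₁ found = found
  ... | inj₂ fail = contradiction (≤-trans
      (budget {m = m} blank+size minor+dom compact t≤d d≤4m (all-fail fail 1≤e)) large) 1+n≰n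
    where
    blank+size : count blank? + size ≡ n
    blank+size = ≤-antisym
      (subst (count blank? + size ≤_) (count-full n)
        (count-⊎ blank? (colored? col) full? (λ _ ¬c c → ¬c c) (λ _ _ → _) (λ _ _ → _)))
      (subst (_≤ count blank? + size) (count-full n) (count-∪ full? blank? (colored? col) λ x _ → split x))
      where
      split : ∀ x → ¬ Colored col x ⊎ Colored col x
      split x with colored? col x
      ... | yes c = inj₂ c
      ... | no ¬c = inj₁ ¬c
    minor+dom : count minor? + t ≤ size
    minor+dom = ≤-trans (+-monoʳ-≤ (count minor?) (subst (_≤ count dominant?) (count-full t)
        (count-injection full? dominant? (λ j u → dom j ≡ u) (λ j _ → dom j , (j , refl) , refl)
          (λ {j} {j'} e e' → hue-injective (just-injective (trans (≡-sym (dom-hue j))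
            (trans (cong col (trans e (≡-sym e'))) (dom-hue j'))))))))
      (count-⊎ minor? dominant? (colored? col) (λ _ (_ , ¬d) d → ¬d d) (λ _ → proj₁) (λ { _ (j , refl) → _ , dom-hue j }))

-- The b-coloring

-- Raising d by 4 permits one more leaf. The weaker bound 2m ≤ d + 1 also holds for d = 1, m = 1,
-- and it is enough for the induction: 2(m + 1) ≤ d + 3.
star-size : ∀ d → 1 ≤ d → ∃[ m ] (1 ≤ m × m + m ≤ suc d × (2 ≤ m → m + m ≤ d) × d ≤ 4 * m)
star-size 1 _ = 1 , s≤s z≤n , ≤-refl , (λ { (s≤s ()) }) , s≤s z≤n
star-size 2 _ = 1 , s≤s z≤n , s≤s (s≤s z≤n) , (λ { (s≤s ()) }) , s≤s (s≤s z≤n)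
star-size 3 _ = 1 , s≤s z≤n , s≤s (s≤s z≤n) , (λ { (s≤s ()) }) , s≤s (s≤s (s≤s z≤n))
star-size 4 _ = 1 , s≤s z≤n , s≤s (s≤s z≤n) , (λ { (s≤s ()) }) , ≤-refl
star-size (suc (suc (suc (suc d@(suc _))))) _ with star-size d (s≤s z≤n)
... | m , 1≤m , 2m≤ , _ , d≤4m = suc m , s≤s z≤n , m≤n⇒m≤1+n 2m+2≤ , (λ _ → 2m+2≤) ,
  ≤-trans (+-monoʳ-≤ 4 d≤4m) (≤-reflexive (≡-sym (*-suc 4 m)))
  where
  2m+2≤ : suc m + suc m ≤ 4 + d
  2m+2≤ = ≤-trans (≤-reflexive (cong suc (+-suc m m))) (≤-trans (+-monoʳ-≤ 2 2m≤) (n≤1+n _))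

module _ {n e : ℕ} (G : Graph n) (regular : Regular G (suc e)) (c4 : C4Free G)
  (large : suc e ^ 3 + suc e ≤ n) where

  Family : ℕ → ℕ → Set
  Family m t = Σ (Fin t → Fin n) λ dom → Σ (State {d = suc e} G dom) λ s →
    State.size s + 2 * m ≤ t * suc (suc e)

  -- From 1 ≤ m < t ≤ d follows d ≥ 2, the positivity of e that the weights require. A new closed
  -- neighborhood costs at most d + 1, so the saving 2m persists.
  grow : ∀ {m t} → 1 ≤ m → suc e ≤ 4 * m → m < t → t ≤ suc e → Family m t → Family m (suc t)
  grow {m} {t} 1≤m d≤4m m<t t≤d (dom , s , compact) with State.missing-hue s t≤d
  ... | i , missing with Step.step G regular c4 s i missing {m}
                           (≤-pred (≤-trans (s≤s 1≤m) (≤-trans m<t t≤d))) t≤d d≤4m compact large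
  ... | x , s' , bound = x Vector.∷ dom , s' , (begin
    State.size s' + 2 * m                         ≤⟨ +-monoˡ-≤ (2 * m) bound ⟩
    State.size s + suc (suc e) + 2 * m            ≡⟨ cong (_+ 2 * m) (+-comm (State.size s) _) ⟩
    suc (suc e) + State.size s + 2 * m            ≡⟨ +-assoc (suc (suc e)) (State.size s) (2 * m) ⟩
    suc (suc e) + (State.size s + 2 * m)          ≤⟨ +-monoʳ-≤ (suc (suc e)) compact ⟩
    suc (suc e) + t * suc (suc e)                 ∎)
    where open ≤-Reasoning

  complete : ∀ {m} → 1 ≤ m → suc e ≤ 4 * m → ∀ f {t} → m < t → t + f ≡ suc (suc e) →
    Family m t → Family m (suc (suc e))
  complete {m} 1≤m d≤4m zero {t} _ e family = subst (Family m) (trans (≡-sym (+-identityʳ t)) e) family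
  complete {m} 1≤m d≤4m (suc f) {t} m<t eq family =
    complete 1≤m d≤4m f (m≤n⇒m≤1+n m<t) (trans (≡-sym (+-suc t f)) eq)
      (grow 1≤m d≤4m m<t (≤-pred (≤-trans (≤-trans (s≤s (m≤m+n t f)) (≤-reflexive (≡-sym (+-suc t f)))) (≤-reflexive eq))) family)

  someVertex : Fin n
  someVertex = fromℕ< {0} (≤-trans (≤-trans (s≤s z≤n) (m≤n+m (suc e) (suc e ^ 3))) large)

  fullState : Σ (Fin (suc (suc e)) → Fin n) (State {d = suc e} G)
  fullState with star-size (suc e) (s≤s z≤n)
  ... | m , 1≤m , 2m≤ , small , d≤4m with m≤n⇒∃[o]m+o≡n m≤d
    where
    m≤d : m ≤ suc e
    m≤d = ≤-pred (≤-trans (+-monoˡ-≤ m 1≤m) 2m≤)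
  ... | f , m+f≡d with complete 1≤m d≤4m f ≤-refl (cong suc m+f≡d) (Star.dom S , Star.state S , Star.compact S)
    where
    S = star G regular c4 someVertex m (subst (m ≤_) m+f≡d (m≤m+n m f)) small
  ... | dom , s , _ = dom , s

  bColoring : HasBColoring G (suc (suc e))
  bColoring with fullState
  ... | dom , s with greedy G regular (State.col s) (State.proper s) (allFin n)
  ... | col' , proper' , keep , all = final , final-proper , dominant
    where
    open State s
    final : Fin n → Fin (suc (suc e))
    final u = proj₁ (all (∈-allFin u))
    final-col : ∀ u → col' u ≡ just (final u)
    final-col u = proj₂ (all (∈-allFin u))
    agrees : ∀ {u c} → col u ≡ just c → final u ≡ c
    agrees {u} c = just-injective (trans (≡-sym (final-col u)) (keep c))
    final-proper : Proper G (suc (suc e)) final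
    final-proper u v a eq = proper' a (final-col u) (trans (final-col v) (cong just (≡-sym eq)))
    hue-surjective : ∀ i → ∃[ j ] (hue j ≡ i)
    hue-surjective i with any? (λ j → hue j ≟ i)
    ... | yes found = found
    ... | no ¬found = contradiction (begin
        suc (suc (suc e))               ≡⟨ cong suc (count-full _) ⟨
        suc (count (full? {suc (suc e)})) ≤⟨ s≤s (count-injection full? (λ c → ¬? (c ≟ i)) (λ j c → hue j ≡ c)
                                             (λ j _ → hue j , (λ eq → ¬found (j , eq)) , refl)
                                             (λ eq eq' → hue-injective (trans eq (≡-sym eq')))) ⟩
        suc (count (λ c → ¬? (c ≟ i)))  ≤⟨ count-avoid₁ (λ c → ¬? (c ≟ i)) i (λ ≢i → ≢i refl) ⟩
        suc (suc e)                     ∎) 1+n≰n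
      where open ≤-Reasoning
    dominant : ∀ i → ∃[ v ] (final v ≡ i × Dominant G (suc (suc e)) final v)
    dominant i with hue-surjective i
    -- Dominance is taken from the partial coloring; the greedy completion keeps the colors that
    -- witness it.
    ... | j , refl = dom j , agrees (dom-hue j) , λ c c≢ →
      let u , a , c∈ = dominance G regular col proper (dom-hue j) (λ _ → saturated j) (rainbow j) c
                         (λ eq → c≢ (trans eq (≡-sym (agrees (dom-hue j)))))
      in u , a , agrees c∈

theorem2p1 : ∀ (d n : ℕ) (G : Graph n) → 1 ≤ d → Regular G d → C4Free G →
    d ^ 3 + d ≤ n → bChromaticIs G (suc d)
theorem2p1 (suc e) n G _ regular c4 large =
  bColoring G regular c4 large , bColoring-bound G regular
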